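{- Let $x(q) = \dfrac{(q;q^2)_\infty}{(q^3;q^6)_\infty^3}$. Then $$\frac{1}{x^2(q)} - 2q\,x(q) = 3q^2\,\frac{(q^2;q^2)_\infty^2 (q^{12};q^{12})_\infty^6}{(q^4;q^4)_\infty^2 (q^6;q^6)_\infty^6} + \frac{(q^4;q^4)_\infty^6}{(q^2;q^2)_\infty^2 (q^6;q^6)_\infty^2 (q^{12};q^{12})_\infty^2}.$$
   Context: Notation: $(a;q)_\infty=\prod_{n\ge1}(1-aq^{n-1})$; the identity is of formal power series in $q$ (equivalently for $|q|<1$). (Here $x(q)=q^{ -1/3}v(q)$ where $v(q)$ is Ramanujan's cubic continued fraction.) -}

module Defs where

open import Data.Nat as ℕ using (ℕ; zero; suc)
open import Data.Integer as ℤ using (ℤ; 0ℤ; 1ℤ; +_; -_; _+_; _*_; _-_)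
open import Data.List using (List; []; _∷_; upTo)
open import Relation.Binary.PropositionalEquality using (_≡_)

-- Formal power series in q with integer coefficients: n ↦ coefficient of q^n.
FPS : Set
FPS = ℕ → ℤ

_≈_ : FPS → FPS → Set
f ≈ g = ∀ n → f n ≡ g n
infix 4 _≈_

sumℤ : List ℤ → ℤ
sumℤ [] = 0ℤ
sumℤ (x ∷ xs) = x + sumℤ xs

mapL : {A B : Set} → (A → B) → List A → List B
mapL f [] = []
mapL f (x ∷ xs) = f x ∷ mapL f xs

const : ℤ → FPS
const c zero = c
const c (suc n) = 0ℤ

one : FPS
one = const 1ℤ

_⊕_ : FPS → FPS → FPS
(f ⊕ g) n = f n + g n
infixl 6 _⊕_

_⊖_ : FPS → FPS → FPS
(f ⊖ g) n = f n - g n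
infixl 6 _⊖_

_·_ : ℤ → FPS → FPS
(c · f) n = c * f n
infixr 7 _·_

_⊛_ : FPS → FPS → FPS
(f ⊛ g) n = sumℤ (mapL (λ k → f k * g (n ℕ.∸ k)) (upTo (suc n)))
infixl 7 _⊛_

qpow : ℕ → FPS
qpow zero zero = 1ℤ
qpow zero (suc n) = 0ℤ
qpow (suc k) zero = 0ℤ
qpow (suc k) (suc n) = qpow k n

_^ₛ_ : FPS → ℕ → FPS
f ^ₛ zero = one
f ^ₛ suc k = f ⊛ (f ^ₛ k)
infixr 8 _^ₛ_

-- Multiplicative inverse of a power series with constant term 1
-- (all series inverted below have constant term 1).  With
-- b₀ = 1, b_{m} = - Σ_{k=1}^{m} f_k b_{m-k}.
-- revInv f m = [b_m , b_{m-1} , … , b_0].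
private
  conv : FPS → ℕ → List ℤ → ℤ
  conv f k [] = 0ℤ
  conv f k (b ∷ bs) = f k * b + conv f (suc k) bs

  revInv : FPS → ℕ → List ℤ
  revInv f zero = 1ℤ ∷ []
  revInv f (suc m) = (- conv f 1 (revInv f m)) ∷ revInv f m

  headℤ : List ℤ → ℤ
  headℤ [] = 0ℤ
  headℤ (x ∷ _) = x

inv : FPS → FPS
inv f n = headℤ (revInv f n)

finProd : ℕ → ℕ → ℕ → FPS
finProd r s zero = one
finProd r s (suc N) = finProd r s N ⊛ (one ⊖ qpow (r ℕ.+ s ℕ.* N))

-- The infinite product (q^r ; q^s)_∞ = ∏_{j≥0} (1 - q^{r+sj}) as a formal
-- power series (for r ≥ 1, s ≥ 1): its coefficient of q^n is that of the
-- finite product over j < n+1, since the factors with j ≥ n+1 are ≡ 1 mod q^{n+1}.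
poch : ℕ → ℕ → FPS
poch r s n = finProd r s (suc n) n

x : FPS
x = poch 1 2 ⊛ inv (poch 3 6 ^ₛ 3)

{-# OPTIONS --safe #-}
-- Write E_k = (q^k; q^k)_∞ and θ = (q^2; q^12)_∞ (q^10; q^12)_∞ E_12, and let Q = ±q.  Over the extension
-- by w = √(-Q), put a = w, b = -Q^2 w and p = ab = Q^3.  By the Jacobi triple product
-- (p; p)_∞ ∏ (1 + a p^j)(1 + b p^j) is a theta series in w; its even and odd parts are again theta series, and
-- the triple product turns them into E_4 and w θ.  Taking norms gives
--   E_4^2 + Q θ^2 = (p; p)_∞^2 ∏ (1 + Q p^{2j})(1 + Q^5 p^{2j}).
-- Up to factors that are series in q^2, the right-hand side is 1/x for Q = q and x for Q = -q:
--   x E_6^4 = (E_4^2 - q θ^2) E_12^2   and   E_6^2 θ = x (E_4^2 + q θ^2) E_12.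
-- In 1/x^2 - 2 q x the terms odd in q cancel, and θ E_4 E_6 = E_2 E_12^2 yields the stated form.
module Submission where

open import Algebra.Bundles using (CommutativeSemiring; CommutativeRing)
import Algebra.Properties.CommutativeSemiring.Exp as Exp
import Algebra.Properties.Group as GroupProperties
import Algebra.Properties.Ring as RingProperties
import Algebra.Solver.Ring.NaturalCoefficients.Default as NatSolver
open import Algebra.Structures using (IsCommutativeRing)
open import Algebra.Structures.Biased using (isCommutativeSemiringˡ; isCommutativeMonoidˡ)
open import Data.Nat as ℕ using (ℕ; zero; suc; NonZero; _≤_; _<_; z≤n; s≤s; _⊓_)
import Data.Nat.Properties as ℕₚ
open import Data.Nat.Solver using (module +-*-Solver)
open import Data.Product using (_×_; _,_; proj₁; proj₂)
open import Data.Sum using (inj₁; inj₂)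
open import Level using (0ℓ)
import Relation.Binary.PropositionalEquality as ≡
open ≡ using (_≡_)
import Relation.Binary.Reasoning.Setoid as SetoidReasoning
open import Relation.Binary.Structures using (IsEquivalence)

-- Finite forms of the Jacobi triple product

-- A factor `1 + c w p^j` has norm `1 + Q c^2 p^(2j)`; this is why a square root of `-Q` is
-- adjoined, and since `Q` is constrained only by `Q * Q = q^2` (and a zero constant term), one
-- computation serves both signs. The extension carries no notion of convergence. The triple product
-- is therefore used there only in its finite form, with Gaussian binomials as coefficients.
-- Components and norms are taken at that stage, where the norm is exactly multiplicative, and only
-- the resulting power series pass to the limit. After multiplication by `(p; p)_∞` the binomials
-- tend to one, while the terms for which they converge slowly carry a high power of `p`. The
-- extension consists of pairs over a commutative semiring, with `N + Q ≈ 0` in place of a minus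
-- sign, so that the polynomial identities have natural coefficients.

double : ℕ → ℕ
double zero = zero
double (suc n) = suc (suc (double n))

triangle : ℕ → ℕ
triangle zero = zero
triangle (suc n) = n ℕ.+ triangle n

-- gap n i is the triangular exponent k (k − 1) / 2 for k = |i − n|.
gap : ℕ → ℕ → ℕ
gap zero i = triangle i
gap (suc n) zero = triangle (suc n)
gap (suc n) (suc i) = gap n i

-- Stated over a semiring because it is instantiated twice: for power series and for their quadratic
-- extension.
module FiniteJacobi (S : CommutativeSemiring 0ℓ 0ℓ) where
  open CommutativeSemiring S hiding (zero)
  open Exp S
  open NatSolver S using (solve; _:=_; _:+_; _:*_; con)
  open SetoidReasoning setoid

  ^-double : ∀ z n → z ^ double n ≈ (z * z) ^ n
  ^-double z zero = refl
  ^-double z (suc n) = trans (sym (*-assoc z z (z ^ double n))) (*-congˡ (^-double z n))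

  sum : (ℕ → Carrier) → ℕ → Carrier
  sum f zero = 0#
  sum f (suc n) = f 0 + sum (λ i → f (suc i)) n

  sum-cong : ∀ {f g} → (∀ i → f i ≈ g i) → ∀ n → sum f n ≈ sum g n
  sum-cong f≈g zero = refl
  sum-cong f≈g (suc n) = +-cong (f≈g 0) (sum-cong (λ i → f≈g (suc i)) n)

  sum-+ : ∀ f g n → sum (λ i → f i + g i) n ≈ sum f n + sum g n
  sum-+ f g zero = sym (+-identityˡ 0#)
  sum-+ f g (suc n) = trans (+-congˡ (sum-+ _ _ n))
    (solve 4 (λ a b c d → (a :+ b) :+ (c :+ d) := (a :+ c) :+ (b :+ d)) refl (f 0) (g 0) _ _)

  sum-*ˡ : ∀ c f n → sum (λ i → c * f i) n ≈ c * sum f n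
  sum-*ˡ c f zero = sym (zeroʳ c)
  sum-*ˡ c f (suc n) = trans (+-congˡ (sum-*ˡ c _ n)) (sym (distribˡ c _ _))

  sum-last : ∀ f n → sum f (suc n) ≈ sum f n + f n
  sum-last f zero = trans (+-identityʳ _) (sym (+-identityˡ _))
  sum-last f (suc n) = trans (+-congˡ (sum-last _ n)) (sym (+-assoc _ _ _))

  sum-double : ∀ f n → sum f (double n) ≈ sum (λ i → f (double i) + f (suc (double i))) n
  sum-double f zero = refl
  sum-double f (suc n) = trans (sym (+-assoc _ _ _)) (+-congˡ (sum-double (λ i → f (suc (suc i))) n))

  prod : (ℕ → Carrier) → ℕ → Carrier
  prod f zero = 1#
  prod f (suc n) = prod f n * f n

  prod-cong : ∀ {f g} → (∀ i → f i ≈ g i) → ∀ n → prod f n ≈ prod g n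
  prod-cong f≈g zero = refl
  prod-cong f≈g (suc n) = *-cong (prod-cong f≈g n) (f≈g n)

  prod-* : ∀ f g n → prod (λ i → f i * g i) n ≈ prod f n * prod g n
  prod-* f g zero = sym (*-identityˡ 1#)
  prod-* f g (suc n) = trans (*-congʳ (prod-* f g n))
    (solve 4 (λ a b c d → (a :* b) :* (c :* d) := (a :* c) :* (b :* d)) refl _ _ (f n) (g n))

  prod-first : ∀ f n → prod f (suc n) ≈ f 0 * prod (λ i → f (suc i)) n
  prod-first f zero = *-comm 1# (f 0)
  prod-first f (suc n) = trans (*-congʳ (prod-first f n)) (*-assoc _ _ _)

  module _ (p : Carrier) where

    -- The Gaussian binomial coefficient, given by a Pascal rule instead of a quotient so that no
    -- division is involved.
    binomial : ℕ → ℕ → Carrier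
    binomial zero zero = 1#
    binomial zero (suc i) = 0#
    binomial (suc n) zero = 1#
    binomial (suc n) (suc i) = binomial n i + p ^ suc i * binomial n (suc i)

    binomial-zero : ∀ n → binomial n 0 ≈ 1#
    binomial-zero zero = refl
    binomial-zero (suc n) = refl

    -- The offset `d` makes the induction work: Pascal's rule also calls for the vanishing one place
    -- further out.
    binomial-beyond : ∀ n d → binomial n (suc (n ℕ.+ d)) ≈ 0#
    binomial-beyond zero d = refl
    binomial-beyond (suc n) d = begin
      binomial n (suc (n ℕ.+ d)) + p ^ suc (suc (n ℕ.+ d)) * binomial n (suc (suc (n ℕ.+ d)))
        ≡⟨ ≡.cong (λ m → binomial n (suc (n ℕ.+ d)) + p ^ suc (suc (n ℕ.+ d)) * binomial n (suc m)) (≡.sym (ℕₚ.+-suc n d)) ⟩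
      binomial n (suc (n ℕ.+ d)) + p ^ suc (suc (n ℕ.+ d)) * binomial n (suc (n ℕ.+ suc d))
        ≈⟨ +-cong (binomial-beyond n d) (*-congˡ (binomial-beyond n (suc d))) ⟩
      0# + p ^ suc (suc (n ℕ.+ d)) * 0#  ≈⟨ trans (+-identityˡ _) (zeroʳ _) ⟩
      0#               ∎

    binomial-top : ∀ n → binomial n (suc n) ≈ 0#
    binomial-top n = ≡.subst (λ m → binomial n (suc m) ≈ 0#) (ℕₚ.+-identityʳ n) (binomial-beyond n 0)

    -- Pascal's rule summed against arbitrary weights. It is the induction step of both
    -- `qBinomialTheorem` and `finiteTripleProduct`.
    sum-pascal : ∀ (x : ℕ → Carrier) n → sum (λ i → binomial (suc n) i * x i) (suc (suc n))
      ≈ sum (λ i → binomial n i * x (suc i)) (suc n) + sum (λ i → binomial n i * (p ^ i * x i)) (suc n)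
    sum-pascal x n = begin
      1# * x 0 + sum (λ i → (binomial n i + p ^ suc i * binomial n (suc i)) * x (suc i)) (suc n)
        ≈⟨ +-cong (*-congʳ (sym (binomial-zero n))) (trans (sum-cong (λ i →
             solve 4 (λ b q c y → (b :+ q :* c) :* y := b :* y :+ c :* (q :* y)) refl
               (binomial n i) (p ^ suc i) (binomial n (suc i)) (x (suc i))) (suc n))
             (sum-+ (λ i → binomial n i * x (suc i)) (λ i → binomial n (suc i) * (p ^ suc i * x (suc i))) (suc n))) ⟩
      binomial n 0 * x 0 + (lower + sum (λ i → binomial n (suc i) * (p ^ suc i * x (suc i))) (suc n))
        ≈⟨ solve 4 (λ b y l u → b :* y :+ (l :+ u) := l :+ (b :* (con 1 :* y) :+ u)) refl _ (x 0) lower _ ⟩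
      lower + sum upper (suc (suc n))           ≈⟨ +-congˡ (sum-last upper (suc n)) ⟩
      lower + (sum upper (suc n) + upper (suc n))
        ≈⟨ +-congˡ (trans (+-congˡ (trans (*-congʳ (binomial-top n)) (zeroˡ _))) (+-identityʳ _)) ⟩
      lower + sum upper (suc n)                 ∎
      where
      lower = sum (λ i → binomial n i * x (suc i)) (suc n)
      upper = λ i → binomial n i * (p ^ i * x i)

    -- Splitting off the factor `j = 0` leaves the same product for `a * p`. The two halves of
    -- `(1 + a) * rest` are then the two sums of `sum-pascal`.
    qBinomialTheorem : ∀ a n → prod (λ j → 1# + a * p ^ j) n
      ≈ sum (λ i → binomial n i * (p ^ triangle i * a ^ i)) (suc n)
    qBinomialTheorem a zero = solve 0 (con 1 := con 1 :* (con 1 :* con 1) :+ con 0) refl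
    qBinomialTheorem a (suc n) = begin
      prod (λ j → 1# + a * p ^ j) (suc n)
        ≈⟨ prod-first _ n ⟩
      (1# + a * 1#) * prod (λ j → 1# + a * (p * p ^ j)) n
        ≈⟨ *-congˡ (trans (prod-cong (λ j → +-congˡ (sym (*-assoc a p _))) n) (qBinomialTheorem (a * p) n)) ⟩
      (1# + a * 1#) * rest
        ≈⟨ solve 2 (λ a r → (con 1 :+ a :* con 1) :* r := a :* r :+ r) refl a rest ⟩
      a * rest + rest
        ≈⟨ +-cong (trans (sym (sum-*ˡ a (λ i → binomial n i * (p ^ triangle i * (a * p) ^ i)) (suc n)))
             (sum-cong raise (suc n))) (sum-cong twist (suc n)) ⟩
      sum (λ i → binomial n i * term (suc i)) (suc n) + sum (λ i → binomial n i * (p ^ i * term i)) (suc n)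
        ≈⟨ sym (sum-pascal term n) ⟩
      sum (λ i → binomial (suc n) i * term i) (suc (suc n)) ∎
      where
      term = λ i → p ^ triangle i * a ^ i
      rest = sum (λ i → binomial n i * (p ^ triangle i * (a * p) ^ i)) (suc n)
      raise : ∀ i → a * (binomial n i * (p ^ triangle i * (a * p) ^ i)) ≈ binomial n i * term (suc i)
      raise i = begin
        a * (binomial n i * (p ^ triangle i * (a * p) ^ i)) ≈⟨ *-congˡ (*-congˡ (*-congˡ (^-distrib-* a p i))) ⟩
        a * (binomial n i * (p ^ triangle i * (a ^ i * p ^ i)))
          ≈⟨ solve 5 (λ a b t x y → a :* (b :* (t :* (x :* y))) := b :* ((y :* t) :* (a :* x))) refl a _ _ _ _ ⟩
        binomial n i * ((p ^ i * p ^ triangle i) * (a * a ^ i)) ≈⟨ *-congˡ (*-congʳ (sym (^-homo-* p i _))) ⟩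
        binomial n i * term (suc i) ∎
      twist : ∀ i → binomial n i * (p ^ triangle i * (a * p) ^ i) ≈ binomial n i * (p ^ i * term i)
      twist i = *-congˡ (trans (*-congˡ (^-distrib-* a p i))
        (solve 3 (λ t x y → t :* (x :* y) := y :* (t :* x)) refl _ _ _))

  -- power a b n i stands for the monomial a^(i − n), where b plays the role of p / a.
  power : Carrier → Carrier → ℕ → ℕ → Carrier
  power a b zero i = a ^ i
  power a b (suc n) zero = b ^ suc n
  power a b (suc n) (suc i) = power a b n i

  -- For `k = i − n` this is `p^(k(k − 1)/2) a^k`. When `k = −m` and `a b = p`, that monomial equals
  -- `p^(m(m − 1)/2) b^m`, so no negative exponent occurs.
  thetaTerm : Carrier → Carrier → Carrier → ℕ → ℕ → Carrier
  thetaTerm p a b n i = p ^ gap n i * power a b n i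

  module _ (p a b : Carrier) (ab≈p : a * b ≈ p) where

    -- A new factor `1 + b p^n` moves the centre from `n` to `suc n`. Its `1` shifts the index,
    -- which is definitional; its `b p^n` must become the weight `p ^ i` required by `sum-pascal`,
    -- and this is that conversion.
    thetaTerm-shift : ∀ n i →
      p ^ i * thetaTerm p a b (suc n) i ≈ (b * p ^ n) * thetaTerm p a b n i
    thetaTerm-shift zero zero =
      solve 1 (λ b → con 1 :* (con 1 :* (b :* con 1)) := (b :* con 1) :* (con 1 :* con 1)) refl b
    thetaTerm-shift zero (suc i) = begin
      (p * p ^ i) * (p ^ triangle i * a ^ i)
        ≈⟨ *-congʳ (*-congʳ (sym ab≈p)) ⟩
      ((a * b) * p ^ i) * (p ^ triangle i * a ^ i)
        ≈⟨ solve 5 (λ a b x t y → ((a :* b) :* x) :* (t :* y) := (b :* con 1) :* ((x :* t) :* (a :* y))) refl a b _ _ _ ⟩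
      (b * 1#) * ((p ^ i * p ^ triangle i) * (a * a ^ i))
        ≈⟨ *-congˡ (*-congʳ (sym (^-homo-* p i _))) ⟩
      (b * 1#) * (p ^ triangle (suc i) * a ^ suc i) ∎
    thetaTerm-shift (suc n) zero = begin
      1# * (p ^ (suc n ℕ.+ triangle (suc n)) * (b * b ^ suc n))
        ≈⟨ *-congˡ (*-congʳ (^-homo-* p (suc n) _)) ⟩
      1# * ((p ^ suc n * p ^ triangle (suc n)) * (b * b ^ suc n))
        ≈⟨ solve 4 (λ x t b y → con 1 :* ((x :* t) :* (b :* y)) := (b :* x) :* (t :* y)) refl _ _ b _ ⟩
      (b * p ^ suc n) * (p ^ triangle (suc n) * b ^ suc n) ∎
    thetaTerm-shift (suc n) (suc i) = begin
      (p * p ^ i) * thetaTerm p a b (suc n) i  ≈⟨ *-assoc p _ _ ⟩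
      p * (p ^ i * thetaTerm p a b (suc n) i)  ≈⟨ *-congˡ (thetaTerm-shift n i) ⟩
      p * ((b * p ^ n) * thetaTerm p a b n i)
        ≈⟨ solve 4 (λ p b x t → p :* ((b :* x) :* t) := (b :* (p :* x)) :* t) refl p b _ _ ⟩
      (b * (p * p ^ n)) * thetaTerm p a b n i  ∎

    -- Induction on the number of `b`-factors, starting from the q-binomial theorem for the
    -- `a`-factors alone.
    finiteTripleProduct : ∀ m n →
      prod (λ j → 1# + a * p ^ j) m * prod (λ j → 1# + b * p ^ j) n
      ≈ sum (λ i → binomial p (n ℕ.+ m) i * thetaTerm p a b n i) (suc (n ℕ.+ m))
    finiteTripleProduct m zero = trans (*-identityʳ _) (qBinomialTheorem p a m)
    finiteTripleProduct m (suc n) = begin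
      left * (prod (λ j → 1# + b * p ^ j) n * (1# + b * p ^ n))
        ≈⟨ solve 3 (λ l r c → l :* (r :* (con 1 :+ c)) := l :* r :+ c :* (l :* r)) refl left _ _ ⟩
      left * right + (b * p ^ n) * (left * right)
        ≈⟨ +-cong (finiteTripleProduct m n) (trans (*-congˡ (finiteTripleProduct m n)) (trans
             (sym (sum-*ˡ (b * p ^ n) (λ i → binomial p (n ℕ.+ m) i * thetaTerm p a b n i) (suc (n ℕ.+ m))))
             (sum-cong (λ i → trans (swap i) (*-congˡ (sym (thetaTerm-shift n i)))) (suc (n ℕ.+ m))))) ⟩
      sum (λ i → binomial p (n ℕ.+ m) i * term (suc i)) (suc (n ℕ.+ m))
        + sum (λ i → binomial p (n ℕ.+ m) i * (p ^ i * term i)) (suc (n ℕ.+ m))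
        ≈⟨ sym (sum-pascal p term (n ℕ.+ m)) ⟩
      sum (λ i → binomial p (suc n ℕ.+ m) i * term i) (suc (suc n ℕ.+ m)) ∎
      where
      left = prod (λ j → 1# + a * p ^ j) m
      right = prod (λ j → 1# + b * p ^ j) n
      term = thetaTerm p a b (suc n)
      swap : ∀ i → (b * p ^ n) * (binomial p (n ℕ.+ m) i * thetaTerm p a b n i)
                 ≈ binomial p (n ℕ.+ m) i * ((b * p ^ n) * thetaTerm p a b n i)
      swap i = solve 3 (λ c d t → c :* (d :* t) := d :* (c :* t)) refl _ _ _

-- Gaussian binomials and q-factorials

module QFactorial (R : CommutativeRing 0ℓ 0ℓ) where
  open CommutativeRing R hiding (zero)
  open FiniteJacobi commutativeSemiring
  open Exp commutativeSemiring
  open NatSolver commutativeSemiring using (solve; _:=_; _:+_; _:*_; con)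
  open SetoidReasoning setoid

  qFactorial : Carrier → ℕ → Carrier
  qFactorial p = prod (λ j → 1# + - (p ^ suc j))

  -- With `y = p^(i+1)` and `z = p^(j+1)` this is what Pascal's rule becomes after multiplication by
  -- the q-factorials.
  one-minus-split : ∀ y z → (1# + - y) + y * (1# + - z) ≈ 1# + - (y * z)
  one-minus-split y z = begin
    (1# + - y) + y * (1# + - z)
      ≈⟨ solve 3 (λ m y w → (con 1 :+ m) :+ y :* (con 1 :+ w) := con 1 :+ ((m :+ y) :+ y :* w)) refl (- y) y (- z) ⟩
    1# + ((- y + y) + y * - z)  ≈⟨ +-congˡ (+-cong (-‿inverseˡ y) (sym (RingProperties.-‿distribʳ-* ring y z))) ⟩
    1# + (0# + - (y * z))       ≈⟨ +-congˡ (+-identityˡ _) ⟩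
    1# + - (y * z)              ∎

  difference-of-squares : ∀ y → (1# + - y) * (1# + y) ≈ 1# + - (y * y)
  difference-of-squares y = trans (solve 2 (λ m y → (con 1 :+ m) :* (con 1 :+ y) := (con 1 :+ m) :+ y :* (con 1 :+ m)) refl (- y) y)
    (one-minus-split y y)

  binomial-full : ∀ p n → binomial p n n ≈ 1#
  binomial-full p zero = refl
  binomial-full p (suc n) = trans (+-cong (binomial-full p n) (trans (*-congˡ (binomial-top p n)) (zeroʳ _))) (+-identityʳ 1#)

  binomial-qFactorial : ∀ p i j → binomial p (i ℕ.+ j) i * (qFactorial p i * qFactorial p j) ≈ qFactorial p (i ℕ.+ j)
  binomial-qFactorial p zero j = trans (*-cong (binomial-zero p j) (*-identityˡ _)) (*-identityˡ _)
  binomial-qFactorial p (suc i) zero rewrite ℕₚ.+-identityʳ i =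
    trans (*-cong (binomial-full p (suc i)) (*-identityʳ _)) (*-identityˡ _)
  binomial-qFactorial p (suc i) (suc j) = begin
    (binomial p (i ℕ.+ suc j) i + y * binomial p (i ℕ.+ suc j) (suc i)) * ((fi * u) * (fj * v))
      ≈⟨ solve 7 (λ b y c fi u fj v → (b :+ y :* c) :* ((fi :* u) :* (fj :* v))
           := (b :* (fi :* (fj :* v))) :* u :+ (c :* ((fi :* u) :* fj)) :* (y :* v)) refl _ y _ fi u fj v ⟩
    (binomial p (i ℕ.+ suc j) i * (fi * (fj * v))) * u
      + (binomial p (i ℕ.+ suc j) (suc i) * ((fi * u) * fj)) * (y * v)
      ≈⟨ +-cong (*-congʳ (binomial-qFactorial p i (suc j)))
           (*-congʳ (trans (*-congʳ (reflexive (≡.cong (λ n → binomial p n (suc i)) (ℕₚ.+-suc i j))))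
             (trans (binomial-qFactorial p (suc i) j) (reflexive (≡.cong (qFactorial p) (≡.sym (ℕₚ.+-suc i j))))))) ⟩
    qFactorial p (i ℕ.+ suc j) * u + qFactorial p (i ℕ.+ suc j) * (y * v)
      ≈⟨ sym (distribˡ _ u (y * v)) ⟩
    qFactorial p (i ℕ.+ suc j) * (u + y * v)
      ≈⟨ *-congˡ (trans (one-minus-split y (p ^ suc j)) (+-congˡ (-‿cong (sym (^-homo-* p (suc i) (suc j)))))) ⟩
    qFactorial p (suc i ℕ.+ suc j) ∎
    where
    y = p ^ suc i
    u = 1# + - (p ^ suc i)
    v = 1# + - (p ^ suc j)
    fi = qFactorial p i
    fj = qFactorial p j

-- Signed powers of q

module SignedPowers (R : CommutativeRing 0ℓ 0ℓ) where
  open CommutativeRing R hiding (zero)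
  open Exp commutativeSemiring
  open NatSolver commutativeSemiring using (solve; _:=_; _:*_; _:^_)
  open RingProperties ring using (-‿distribˡ-*; -‿distribʳ-*)

  neg-*-neg : ∀ y z → - y * - z ≈ y * z
  neg-*-neg y z = trans (sym (-‿distribˡ-* y (- z)))
    (trans (-‿cong (sym (-‿distribʳ-* y z))) (GroupProperties.⁻¹-involutive +-group (y * z)))

  -- Here `s` is `q^2` and `Q` is either of its square roots `q` and `-q`. The element `c` is the
  -- coefficient of `√N` in `b`, and `p = N * c` is the product of `√N` and `c √N`.
  module _ (Q s : Carrier) (Q²≈s : Q * Q ≈ s) where
    private
      N c p : Carrier
      N = - Q
      c = - s
      p = N * c

      N² : N * N ≈ s
      N² = trans (neg-*-neg Q Q) Q²≈s

      c² : c * c ≈ s * s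
      c² = neg-*-neg s s

      negated : ∀ {y} m → y ≈ m * c → y ≈ - (m * s)
      negated m e = trans e (sym (-‿distribʳ-* m s))

    p≈Qs : p ≈ Q * s
    p≈Qs = neg-*-neg Q s

    p² : p * p ≈ s ^ 3
    p² = trans (solve 2 (λ n c → (n :* c) :* (n :* c) := (n :* n) :* (c :* c)) refl N c)
      (trans (*-cong N² c²) (solve 1 (λ s → s :* (s :* s) := s :^ 3) refl s))

    p⁴ : p ^ 4 ≈ s ^ 6
    p⁴ = trans (solve 1 (λ p → p :^ 4 := (p :* p) :* (p :* p)) refl p)
      (trans (*-cong p² p²) (solve 1 (λ s → s :^ 3 :* s :^ 3 := s :^ 6) refl s))

    -- This and the next two lemmas evaluate the parameters of the theta series in `p ^ 4 = q^12`:
    -- `-q^4` and `-q^8` for the even part, `-q^10` for the odd part, where it is paired with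
    -- `c = -q^2`. The sign of `Q` has disappeared from all of them.
    pN : p ^ 1 * N ≈ - (s * s)
    pN = negated s (trans (solve 2 (λ n c → (n :* c) :^ 1 :* n := (n :* n) :* c) refl N c) (*-congʳ N²))

    pNc² : p ^ 1 * (N * (c * c)) ≈ - (s ^ 3 * s)
    pNc² = negated (s ^ 3) (trans
      (solve 2 (λ n c → (n :* c) :^ 1 :* (n :* (c :* c)) := ((n :* c) :* (n :* c)) :* c) refl N c) (*-congʳ p²))

    p³N : p ^ 3 * N ≈ - (s ^ 4 * s)
    p³N = negated (s ^ 4) (trans (solve 2 (λ n c → (n :* c) :^ 3 :* n := ((n :* c) :* (n :* c)) :* (n :* n) :* c) refl N c)
      (*-congʳ (trans (*-cong p² N²) (solve 1 (λ s → s :^ 3 :* s := s :^ 4) refl s))))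

    even-product : (p ^ 1 * N) * (p ^ 1 * (N * (c * c))) ≈ p ^ 4
    even-product = solve 2 (λ n c → ((n :* c) :^ 1 :* n) :* ((n :* c) :^ 1 :* (n :* (c :* c))) := (n :* c) :^ 4) refl N c

    odd-product : (p ^ 3 * N) * c ≈ p ^ 4
    odd-product = solve 2 (λ n c → ((n :* c) :^ 3 :* n) :* c := (n :* c) :^ 4) refl N c

-- Adjoining a square root

double≡+ : ∀ n → double n ≡ n ℕ.+ n
double≡+ zero = ≡.refl
double≡+ (suc n) = ≡.cong suc (≡.trans (≡.cong suc (double≡+ n)) (≡.sym (ℕₚ.+-suc n n)))

-- On indices of one parity the quadratic exponent is four times a triangular one, so the base `p`
-- becomes `p ^ 4`. The linear remainder, `n` here and `3 n` for odd indices, is absorbed into the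
-- parameters as `p ^ 1` and `p ^ 3`.
triangle-double : ∀ n → triangle (double n) ≡ 4 ℕ.* triangle n ℕ.+ n
triangle-double zero = ≡.refl
triangle-double (suc n) = ≡.trans
  (≡.cong₂ (λ d t → suc d ℕ.+ (d ℕ.+ t)) (double≡+ n) (triangle-double n))
  (solve 2 (λ n t → (con 1 :+ (n :+ n)) :+ ((n :+ n) :+ (con 4 :* t :+ n))
     := con 4 :* (n :+ t) :+ (con 1 :+ n)) ≡.refl n (triangle n))
  where open +-*-Solver

triangle-suc-double : ∀ n → triangle (suc (double n)) ≡ 4 ℕ.* triangle n ℕ.+ 3 ℕ.* n
triangle-suc-double n = ≡.trans (≡.cong₂ ℕ._+_ (double≡+ n) (triangle-double n))
  (solve 2 (λ n t → (n :+ n) :+ (con 4 :* t :+ n) := con 4 :* t :+ con 3 :* n) ≡.refl n (triangle n))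
  where open +-*-Solver

module QuadraticExtension (S : CommutativeSemiring 0ℓ 0ℓ) (N : CommutativeSemiring.Carrier S) where
  open CommutativeSemiring S hiding (zero)
  open NatSolver S using (solve; _:=_; _:+_; _:*_; con)

  infix 4 _≈ₖ_
  _≈ₖ_ : Carrier × Carrier → Carrier × Carrier → Set
  (f , g) ≈ₖ (f′ , g′) = (f ≈ f′) × (g ≈ g′)

  -- (f , g) stands for f + g √N.
  S[√N] : CommutativeSemiring 0ℓ 0ℓ
  S[√N] = record
    { Carrier = Carrier × Carrier
    ; _≈_ = _≈ₖ_
    ; _+_ = λ z w → proj₁ z + proj₁ w , proj₂ z + proj₂ w
    ; _*_ = λ z w → proj₁ z * proj₁ w + N * (proj₂ z * proj₂ w) , proj₁ z * proj₂ w + proj₂ z * proj₁ w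
    ; 0# = 0# , 0#
    ; 1# = 1# , 0#
    ; isCommutativeSemiring = isCommutativeSemiringˡ record
      { +-isCommutativeMonoid = isCommutativeMonoidˡ record
        { isSemigroup = record
          { isMagma = record
            { isEquivalence = isEquivalenceₖ
            ; ∙-cong = λ (e , e′) (d , d′) → +-cong e d , +-cong e′ d′ }
          ; assoc = λ _ _ _ → +-assoc _ _ _ , +-assoc _ _ _ }
        ; identityˡ = λ _ → +-identityˡ _ , +-identityˡ _
        ; comm = λ _ _ → +-comm _ _ , +-comm _ _ }
      ; *-isCommutativeMonoid = isCommutativeMonoidˡ record
        { isSemigroup = record
          { isMagma = record
            { isEquivalence = isEquivalenceₖ
            ; ∙-cong = λ (e , e′) (d , d′) →
                +-cong (*-cong e d) (*-congˡ (*-cong e′ d′)) , +-cong (*-cong e d′) (*-cong e′ d) }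
          ; assoc = λ (a , b) (c , d) (e , f) →
              solve 7 (λ n a b c d e f → (a :* c :+ n :* (b :* d)) :* e :+ n :* ((a :* d :+ b :* c) :* f)
                := a :* (c :* e :+ n :* (d :* f)) :+ n :* (b :* (c :* f :+ d :* e))) refl N a b c d e f ,
              solve 7 (λ n a b c d e f → (a :* c :+ n :* (b :* d)) :* f :+ (a :* d :+ b :* c) :* e
                := a :* (c :* f :+ d :* e) :+ b :* (c :* e :+ n :* (d :* f))) refl N a b c d e f }
        ; identityˡ = λ (a , b) →
            solve 3 (λ n a b → con 1 :* a :+ n :* (con 0 :* b) := a) refl N a b ,
            solve 2 (λ a b → con 1 :* b :+ con 0 :* a := b) refl a b
        ; comm = λ (a , b) (c , d) →
            solve 5 (λ n a b c d → a :* c :+ n :* (b :* d) := c :* a :+ n :* (d :* b)) refl N a b c d ,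
            solve 4 (λ a b c d → a :* d :+ b :* c := c :* b :+ d :* a) refl a b c d }
      ; distribʳ = λ (a , b) (c , d) (e , f) →
          solve 7 (λ n a b c d e f → (c :+ e) :* a :+ n :* ((d :+ f) :* b)
            := (c :* a :+ n :* (d :* b)) :+ (e :* a :+ n :* (f :* b))) refl N a b c d e f ,
          solve 6 (λ a b c d e f → (c :+ e) :* b :+ (d :+ f) :* a
            := (c :* b :+ d :* a) :+ (e :* b :+ f :* a)) refl a b c d e f
      ; zeroˡ = λ (a , b) →
          solve 3 (λ n a b → con 0 :* a :+ n :* (con 0 :* b) := con 0) refl N a b ,
          solve 2 (λ a b → con 0 :* b :+ con 0 :* a := con 0) refl a b } }
    where
    isEquivalenceₖ : IsEquivalence _≈ₖ_
    isEquivalenceₖ = record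
      { refl = refl , refl
      ; sym = λ (e , e′) → sym e , sym e′
      ; trans = λ (e , e′) (d , d′) → trans e d , trans e′ d′ }

  open Exp S
  open FiniteJacobi S
  module K = CommutativeSemiring S[√N]
  module KJ = FiniteJacobi S[√N]
  module KE = Exp S[√N]

  ι : Carrier → K.Carrier
  ι c = c , 0#

  √N : K.Carrier
  √N = 0# , 1#

  ι-* : ∀ c f g → ι c K.* (f , g) ≈ₖ (c * f , c * g)
  ι-* c f g = solve 4 (λ n c f g → c :* f :+ n :* (con 0 :* g) := c :* f) refl N c f g ,
              solve 3 (λ c f g → c :* g :+ con 0 :* f := c :* g) refl c f g

  imaginary-* : ∀ f g → (0# , f) K.* (0# , g) ≈ₖ ι (N * (f * g))
  imaginary-* f g = solve 3 (λ n f g → con 0 :* con 0 :+ n :* (f :* g) := n :* (f :* g)) refl N f g ,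
                    solve 2 (λ f g → con 0 :* g :+ f :* con 0 := con 0) refl f g

  ι-*-ι : ∀ c d → ι c K.* ι d ≈ₖ ι (c * d)
  ι-*-ι c d = K.trans (ι-* c d 0#) (refl , zeroʳ c)

  ι-^ : ∀ c n → ι c KE.^ n ≈ₖ ι (c ^ n)
  ι-^ c zero = K.refl
  ι-^ c (suc n) = K.trans (K.*-congˡ (ι-^ c n)) (ι-*-ι c (c ^ n))

  ι-binomial : ∀ p n i → KJ.binomial (ι p) n i ≈ₖ ι (binomial p n i)
  ι-binomial p zero zero = K.refl
  ι-binomial p zero (suc i) = K.refl
  ι-binomial p (suc n) zero = K.refl
  ι-binomial p (suc n) (suc i) = K.trans
    (K.+-cong (ι-binomial p n i) (K.trans (K.*-cong (ι-^ p (suc i)) (ι-binomial p n (suc i))) (ι-*-ι _ _)))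
    (refl , +-identityʳ 0#)

  sum-components : ∀ f n → KJ.sum f n ≈ₖ (sum (λ i → proj₁ (f i)) n , sum (λ i → proj₂ (f i)) n)
  sum-components f zero = K.refl
  sum-components f (suc n) = K.+-congˡ {x = f 0} (sum-components (λ i → f (suc i)) n)

  thetaTerm-components : ∀ p a b n i → KJ.thetaTerm (ι p) a b n i ≈ₖ
    (p ^ gap n i * proj₁ (KJ.power a b n i) , p ^ gap n i * proj₂ (KJ.power a b n i))
  thetaTerm-components p a b n i = K.trans (K.*-congʳ (ι-^ p (gap n i))) (ι-* _ _ _)

  square-^ : ∀ z f n → z K.* z ≈ₖ ι f → z KE.^ double n ≈ₖ ι (f ^ n)
  square-^ z f zero e = K.refl
  square-^ z f (suc n) e = K.trans (K.sym (K.*-assoc z z (z KE.^ double n)))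
    (K.trans (K.*-cong e (square-^ z f n e)) (ι-*-ι f (f ^ n)))

  -- Since `p` lies in the base, so do the binomials and the powers of `p`; they act on each
  -- component separately, and only `power a b` mixes the components.
  finiteTripleProduct-components : ∀ p a b → a K.* b ≈ₖ ι p → ∀ m n →
    KJ.prod (λ j → K.1# K.+ a K.* ι p KE.^ j) m K.* KJ.prod (λ j → K.1# K.+ b K.* ι p KE.^ j) n ≈ₖ
    (sum (λ i → binomial p (n ℕ.+ m) i * (p ^ gap n i * proj₁ (KJ.power a b n i))) (suc (n ℕ.+ m)) ,
     sum (λ i → binomial p (n ℕ.+ m) i * (p ^ gap n i * proj₂ (KJ.power a b n i))) (suc (n ℕ.+ m)))
  finiteTripleProduct-components p a b ab≈p m n = K.trans (KJ.finiteTripleProduct (ι p) a b ab≈p m n)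
    (K.trans (KJ.sum-cong (λ i → K.trans (K.*-cong (ι-binomial p (n ℕ.+ m) i) (thetaTerm-components p a b n i))
      (ι-* _ _ _)) (suc (n ℕ.+ m))) (sum-components (λ i →
        binomial p (n ℕ.+ m) i * (p ^ gap n i * proj₁ (KJ.power a b n i)) ,
        binomial p (n ℕ.+ m) i * (p ^ gap n i * proj₂ (KJ.power a b n i))) (suc (n ℕ.+ m))))

  -- For `Q = -N` this is the norm `f^2 − N g^2`; the separate `Q` avoids a subtraction.
  norm : Carrier → K.Carrier → Carrier
  norm Q (f , g) = f * f + Q * (g * g)

  module _ (Q : Carrier) (N+Q≈0 : N + Q ≈ 0#) where
    open SetoidReasoning setoid

    norm-* : ∀ z w → norm Q (z K.* w) ≈ norm Q z * norm Q w
    norm-* (f , g) (f′ , g′) = begin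
      norm Q ((f , g) K.* (f′ , g′))          ≈⟨ sym (+-identityʳ _) ⟩
      norm Q ((f , g) K.* (f′ , g′)) + 0#     ≈⟨ +-congˡ (sym (vanish _)) ⟩
      -- Adding suitable multiples of `N + Q` to both sides turns the claim into a polynomial
      -- identity with natural coefficients in independent `N` and `Q`.
      norm Q ((f , g) K.* (f′ , g′)) + (N + Q) * (Q * (g * g * (g′ * g′)))
        ≈⟨ solve 6 (λ n q f g f′ g′ →
             ((f :* f′ :+ n :* (g :* g′)) :* (f :* f′ :+ n :* (g :* g′))
               :+ q :* ((f :* g′ :+ g :* f′) :* (f :* g′ :+ g :* f′)))
               :+ (n :+ q) :* (q :* (g :* g :* (g′ :* g′)))
             := (f :* f :+ q :* (g :* g)) :* (f′ :* f′ :+ q :* (g′ :* g′))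
               :+ (n :+ q) :* (f :* f′ :* (g :* g′) :+ f :* f′ :* (g :* g′) :+ n :* (g :* g :* (g′ :* g′))))
             refl N Q f g f′ g′ ⟩
      norm Q (f , g) * norm Q (f′ , g′)
        + (N + Q) * (f * f′ * (g * g′) + f * f′ * (g * g′) + N * (g * g * (g′ * g′))) ≈⟨ +-congˡ (vanish _) ⟩
      norm Q (f , g) * norm Q (f′ , g′) + 0#  ≈⟨ +-identityʳ _ ⟩
      norm Q (f , g) * norm Q (f′ , g′)       ∎
      where
      vanish : ∀ y → (N + Q) * y ≈ 0#
      vanish y = trans (*-congʳ N+Q≈0) (zeroˡ y)

  norm-scale : ∀ Q c z → (c * proj₁ z) * (c * proj₁ z) + Q * ((c * proj₂ z) * (c * proj₂ z)) ≈ (c * c) * norm Q z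
  norm-scale Q c (f , g) = solve 4 (λ c q f g → (c :* f) :* (c :* f) :+ q :* ((c :* g) :* (c :* g))
    := (c :* c) :* (f :* f :+ q :* (g :* g))) refl c Q f g

  norm-cong : ∀ Q {z w} → z ≈ₖ w → norm Q z ≈ norm Q w
  norm-cong Q (e , e′) = +-cong (*-cong e e) (*-congˡ (*-cong e′ e′))

  norm-prod : ∀ Q → N + Q ≈ 0# → ∀ c p n →
    norm Q (KJ.prod (λ j → K.1# K.+ (0# , c) K.* ι p KE.^ j) n) ≈ prod (λ j → 1# + Q * (c * p ^ j * (c * p ^ j))) n
  norm-prod Q N+Q≈0 c p zero =
    solve 1 (λ q → con 1 :* con 1 :+ q :* (con 0 :* con 0) := con 1) refl Q
  norm-prod Q N+Q≈0 c p (suc n) = trans (norm-* Q N+Q≈0 (KJ.prod _ n) _)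
    (*-cong (norm-prod Q N+Q≈0 c p n) (trans (norm-cong Q factor)
      (solve 2 (λ q y → con 1 :* con 1 :+ q :* (y :* y) := con 1 :+ q :* (y :* y)) refl Q (c * p ^ n))))
    where
    factor : K.1# K.+ (0# , c) K.* ι p KE.^ n ≈ₖ (1# , c * p ^ n)
    factor = K.trans (K.+-congˡ {x = K.1#} (K.trans (K.*-congˡ (ι-^ p n)) (K.trans (K.*-comm (0# , c) (ι (p ^ n)))
        (ι-* (p ^ n) 0# c))))
      (trans (+-congˡ (zeroʳ _)) (+-identityʳ _) , trans (+-identityˡ _) (*-comm _ _))

  -- The terms of f(a, b) with a = √N, b = c √N and ab = p: those of even index have no √N part,
  -- those of odd index have only a √N part.
  module _ (c p : Carrier) (Nc≈p : N * c ≈ p) where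
    open SetoidReasoning setoid

    private
      b : K.Carrier
      b = 0# , c

      b² : Carrier
      b² = N * (c * c)

      √N-even : ∀ n → √N KE.^ double n ≈ₖ ι (N ^ n)
      √N-even n = square-^ √N N n (K.trans (imaginary-* 1# 1#) (trans (*-congˡ (*-identityˡ 1#)) (*-identityʳ N) , refl))

      √N-odd : ∀ n → √N KE.^ suc (double n) ≈ₖ (0# , N ^ n)
      √N-odd n = K.trans (K.*-congˡ (√N-even n)) (K.trans (K.*-comm √N (ι (N ^ n)))
        (K.trans (ι-* _ 0# 1#) (zeroʳ _ , *-identityʳ _)))

      b-even : ∀ n → b KE.^ double n ≈ₖ ι (b² ^ n)
      b-even n = square-^ b b² n (imaginary-* c c)

      b-odd : ∀ n → b KE.^ suc (double n) ≈ₖ (0# , b² ^ n * c)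
      b-odd n = K.trans (K.*-congˡ (b-even n)) (K.trans (K.*-comm b (ι (b² ^ n)))
        (K.trans (ι-* _ 0# c) (zeroʳ _ , refl)))

      regroup : ∀ d y n t → p ^ (4 ℕ.* t ℕ.+ d ℕ.* n) * y ^ n ≈ (p ^ 4) ^ t * (p ^ d * y) ^ n
      regroup d y n t = begin
        p ^ (4 ℕ.* t ℕ.+ d ℕ.* n) * y ^ n          ≈⟨ *-congʳ (^-homo-* p (4 ℕ.* t) (d ℕ.* n)) ⟩
        p ^ (4 ℕ.* t) * p ^ (d ℕ.* n) * y ^ n
          ≈⟨ *-congʳ (*-cong (sym (^-assocʳ p 4 t)) (sym (^-assocʳ p d n))) ⟩
        (p ^ 4) ^ t * (p ^ d) ^ n * y ^ n          ≈⟨ *-assoc _ _ _ ⟩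
        (p ^ 4) ^ t * ((p ^ d) ^ n * y ^ n)        ≈⟨ *-congˡ (sym (^-distrib-* (p ^ d) y n)) ⟩
        (p ^ 4) ^ t * (p ^ d * y) ^ n              ∎

      regroup-even : ∀ y n → p ^ triangle (double n) * y ^ n ≈ (p ^ 4) ^ triangle n * (p ^ 1 * y) ^ n
      regroup-even y n = trans (*-congʳ (^-congʳ p (≡.trans (triangle-double n)
        (≡.cong (4 ℕ.* triangle n ℕ.+_) (≡.sym (ℕₚ.*-identityˡ n)))))) (regroup 1 y n (triangle n))

      regroup-odd : ∀ y n → p ^ triangle (suc (double n)) * y ^ n ≈ (p ^ 4) ^ triangle n * (p ^ 3 * y) ^ n
      regroup-odd y n = trans (*-congʳ (^-congʳ p (triangle-suc-double n))) (regroup 3 y n (triangle n))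

      -- The odd exponent `−(2n + 1)` is `2k + 1` for `k = −(n + 1)`, so it belongs to the term at
      -- distance `suc n`, not `n`, from the centre of the odd theta series. The surplus `c`
      -- supplies the extra factor.
      regroup-b-odd : ∀ n → p ^ triangle (suc (double n)) * (b² ^ n * c)
        ≈ (p ^ 4) ^ triangle (suc n) * c ^ suc n
      regroup-b-odd n = begin
        p ^ triangle (suc (double n)) * (b² ^ n * c)          ≈⟨ sym (*-assoc _ _ _) ⟩
        p ^ triangle (suc (double n)) * b² ^ n * c            ≈⟨ *-congʳ (regroup-odd b² n) ⟩
        (p ^ 4) ^ triangle n * (p ^ 3 * b²) ^ n * c           ≈⟨ *-congʳ (*-congˡ (^-congˡ n shift)) ⟩
        (p ^ 4) ^ triangle n * (p ^ 4 * c) ^ n * c            ≈⟨ *-congʳ (*-congˡ (^-distrib-* (p ^ 4) c n)) ⟩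
        (p ^ 4) ^ triangle n * ((p ^ 4) ^ n * c ^ n) * c
          ≈⟨ solve 4 (λ t x y c → t :* (x :* y) :* c := (x :* t) :* (c :* y)) refl ((p ^ 4) ^ triangle n) ((p ^ 4) ^ n) (c ^ n) c ⟩
        ((p ^ 4) ^ n * (p ^ 4) ^ triangle n) * (c * c ^ n)    ≈⟨ *-congʳ (sym (^-homo-* (p ^ 4) n (triangle n))) ⟩
        (p ^ 4) ^ triangle (suc n) * c ^ suc n                ∎
        where
        shift : p ^ 3 * (N * (c * c)) ≈ p ^ 4 * c
        shift = begin
          p ^ 3 * (N * (c * c))   ≈⟨ *-congˡ (trans (sym (*-assoc N c c)) (*-congʳ Nc≈p)) ⟩
          p ^ 3 * (p * c)         ≈⟨ solve 3 (λ x p c → x :* (p :* c) := (p :* x) :* c) refl (p ^ 3) p c ⟩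
          p ^ 4 * c               ∎

      even-component : ∀ {u y z} (w : K.Carrier) → w ≈ₖ ι y → u * y ≈ z →
        (u * proj₁ w , u * proj₂ w) ≈ₖ ι z
      even-component w (e , e′) r = trans (*-congˡ e) r , trans (*-congˡ e′) (zeroʳ _)

      odd-component : ∀ {u y z} (w : K.Carrier) → w ≈ₖ (0# , y) → u * y ≈ z →
        (u * proj₁ w , u * proj₂ w) ≈ₖ (0# , z)
      odd-component w (e , e′) r = trans (*-congˡ e) (zeroʳ _) , trans (*-congˡ e′) r

    component : ℕ → ℕ → K.Carrier
    component n i = p ^ gap n i * proj₁ (KJ.power √N b n i) , p ^ gap n i * proj₂ (KJ.power √N b n i)

    -- `gap` and `power` cancel successors in pairs, so the last clause holds by computation from
    -- the recursive call; only the two rays from the centre need an argument.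
    component-even : ∀ n i → component (double n) (double i) ≈ₖ ι (thetaTerm (p ^ 4) (p ^ 1 * N) (p ^ 1 * b²) n i)
    component-even zero i = even-component _ (√N-even i) (regroup-even N i)
    component-even (suc n) zero = even-component _ (b-even (suc n)) (regroup-even b² (suc n))
    component-even (suc n) (suc i) = component-even n i

    component-odd : ∀ n i → component (double n) (suc (double i)) ≈ₖ (0# , thetaTerm (p ^ 4) (p ^ 3 * N) c n i)
    component-odd zero i = odd-component _ (√N-odd i) (regroup-odd N i)
    component-odd (suc n) zero = odd-component _ (b-odd n) (regroup-b-odd n)
    component-odd (suc n) (suc i) = component-odd n i

    sum-component : ∀ n m →
      (sum (λ i → proj₁ (component (double n) i)) (double m) , sum (λ i → proj₂ (component (double n) i)) (double m)) ≈ₖ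
      (sum (thetaTerm (p ^ 4) (p ^ 1 * N) (p ^ 1 * b²) n) m , sum (thetaTerm (p ^ 4) (p ^ 3 * N) c n) m)
    sum-component n m =
      trans (sum-double _ m) (sum-cong (λ i → trans (+-cong (proj₁ (component-even n i)) (proj₁ (component-odd n i))) (+-identityʳ _)) m) ,
      trans (sum-double _ m) (sum-cong (λ i → trans (+-cong (proj₂ (component-even n i)) (proj₂ (component-odd n i))) (+-identityˡ _)) m)

-- Elimination between the product relations

module Elimination (S : CommutativeSemiring 0ℓ 0ℓ) where
  open CommutativeSemiring S
  open Exp S
  open NatSolver S using (solve; _:=_; _:+_; _:*_; _:^_)
  open SetoidReasoning setoid

  -- The variable `d` stands for `e₄^2 − q θ^2`, the term `2 q x` is moved to the right, and
  -- inverses are separate variables. The integers 3 and 2 appear as repeated sums. Both sides are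
  -- compared after multiplication by the invertible `e₆ ^ 4 * θ ^ 2`.
  eliminate : ∀ {q q² x x⁻² o₁ o₃ o₃⁻¹ u₃ g₊ g₋ e₂ e₄ e₆ e₁₂ θ d w⁻¹ r₁ r₂ : Carrier} →
    q² ≈ q * q → x * o₃ ^ 3 ≈ o₁ → o₃⁻¹ * o₃ ≈ 1# → o₁ ≈ g₋ * o₃ →
    e₄ * e₄ + q * (θ * θ) ≈ (o₃ * e₆) ^ 2 * g₊ → d ≈ (u₃ * e₆) ^ 2 * g₋ → d + q * (θ * θ) ≈ e₄ * e₄ →
    o₃ * u₃ * e₁₂ ≈ e₆ → g₊ * g₋ * e₁₂ ≈ θ → θ * e₄ * e₆ ≈ e₂ * e₁₂ ^ 2 →
    x⁻² * x ^ 2 ≈ 1# → w⁻¹ * (e₆ ^ 4 * θ ^ 2) ≈ 1# →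
    r₁ * (e₄ ^ 2 * e₆ ^ 6) ≈ 1# → r₂ * (e₂ ^ 2 * e₆ ^ 2 * e₁₂ ^ 2) ≈ 1# →
    x⁻² ≈ (q² * ((e₂ ^ 2 * e₁₂ ^ 6) * r₁) + q² * ((e₂ ^ 2 * e₁₂ ^ 6) * r₁) + q² * ((e₂ ^ 2 * e₁₂ ^ 6) * r₁)
            + e₄ ^ 6 * r₂) + (q * x + q * x)
  eliminate {q} {q²} {x} {x⁻²} {o₁} {o₃} {o₃⁻¹} {u₃} {g₊} {g₋} {e₂} {e₄} {e₆} {e₁₂} {θ} {d} {w⁻¹} {r₁} {r₂}
    hq hx ho h₁ h₊ h₋ hd h₂ h₃ h₄ hX hw hr₁ hr₂ = cancel (begin
      x⁻² * (e₆ ^ 4 * θ ^ 2)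
        ≈⟨ squared ⟩
      ((e₄ * e₄ + t) * e₁₂) ^ 2
        ≈⟨ ^-congˡ 2 (*-congʳ (+-congʳ (sym hd))) ⟩
      ((d + t + t) * e₁₂) ^ 2
        -- The decisive identity is `(d + 2t)^2 = 3 t^2 + (d + t)^2 + 2 t d`. Its three parts yield
        -- the term with coefficient 3, the other quotient (as `d + t = e₄^2`), and `2 q x`.
        ≈⟨ solve 3 (λ d t e → ((d :+ t :+ t) :* e) :^ 2
             := t :^ 2 :* e :^ 2 :+ t :^ 2 :* e :^ 2 :+ t :^ 2 :* e :^ 2 :+ (d :+ t) :^ 2 :* e :^ 2
                :+ (t :* (d :* e :^ 2) :+ t :* (d :* e :^ 2))) refl d t e₁₂ ⟩
      t ^ 2 * e₁₂ ^ 2 + t ^ 2 * e₁₂ ^ 2 + t ^ 2 * e₁₂ ^ 2 + (d + t) ^ 2 * e₁₂ ^ 2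
        + (t * (d * e₁₂ ^ 2) + t * (d * e₁₂ ^ 2))
        ≈⟨ sym (+-cong (+-cong (+-cong (+-cong first first) first) (trans second (*-congʳ (^-congˡ 2 (sym hd))))) (+-cong third third)) ⟩
      y * w + y * w + y * w + z * w + (q * x * w + q * x * w)
        ≈⟨ solve 4 (λ y z v w → y :* w :+ y :* w :+ y :* w :+ z :* w :+ (v :* w :+ v :* w)
             := (y :+ y :+ y :+ z :+ (v :+ v)) :* w) refl y z (q * x) w ⟩
      (y + y + y + z + (q * x + q * x)) * (e₆ ^ 4 * θ ^ 2) ∎)
    where
    t = q * (θ * θ)
    w = e₆ ^ 4 * θ ^ 2
    y = q² * ((e₂ ^ 2 * e₁₂ ^ 6) * r₁)
    z = e₄ ^ 6 * r₂

    cancel : ∀ {a b} → a * w ≈ b * w → a ≈ b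
    cancel {a} {b} e = begin
      a                ≈⟨ sym (*-identityʳ a) ⟩
      a * 1#           ≈⟨ *-congˡ (sym hw) ⟩
      a * (w⁻¹ * w)    ≈⟨ solve 3 (λ a i w → a :* (i :* w) := i :* (a :* w)) refl a w⁻¹ w ⟩
      w⁻¹ * (a * w)    ≈⟨ *-congˡ e ⟩
      w⁻¹ * (b * w)    ≈⟨ solve 3 (λ a i w → i :* (a :* w) := a :* (i :* w)) refl b w⁻¹ w ⟩
      b * (w⁻¹ * w)    ≈⟨ *-congˡ hw ⟩
      b * 1#           ≈⟨ *-identityʳ b ⟩
      b                ∎

    x-o₃ : x * o₃ ^ 2 ≈ g₋
    x-o₃ = begin
      x * o₃ ^ 2               ≈⟨ sym (*-identityˡ _) ⟩
      1# * (x * o₃ ^ 2)        ≈⟨ *-congʳ (sym ho) ⟩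
      o₃⁻¹ * o₃ * (x * o₃ ^ 2) ≈⟨ solve 3 (λ i o x → i :* o :* (x :* o :^ 2) := i :* (x :* o :^ 3)) refl o₃⁻¹ o₃ x ⟩
      o₃⁻¹ * (x * o₃ ^ 3)      ≈⟨ *-congˡ (trans hx h₁) ⟩
      o₃⁻¹ * (g₋ * o₃)         ≈⟨ solve 3 (λ i o g → i :* (g :* o) := i :* o :* g) refl o₃⁻¹ o₃ g₋ ⟩
      o₃⁻¹ * o₃ * g₋           ≈⟨ *-congʳ ho ⟩
      1# * g₋                  ≈⟨ *-identityˡ g₋ ⟩
      g₋                       ∎

    x-even-odd : x * e₆ ^ 4 ≈ d * e₁₂ ^ 2
    x-even-odd = begin
      x * e₆ ^ 4
        ≈⟨ solve 2 (λ x e → x :* e :^ 4 := x :* (e :^ 2 :* e :^ 2)) refl x e₆ ⟩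
      x * (e₆ ^ 2 * e₆ ^ 2)
        ≈⟨ *-congˡ (*-congʳ (^-congˡ 2 (sym h₂))) ⟩
      x * ((o₃ * u₃ * e₁₂) ^ 2 * e₆ ^ 2)
        ≈⟨ solve 5 (λ x o u e f → x :* ((o :* u :* e) :^ 2 :* f :^ 2) := (u :* f) :^ 2 :* (x :* o :^ 2) :* e :^ 2) refl x o₃ u₃ e₁₂ e₆ ⟩
      (u₃ * e₆) ^ 2 * (x * o₃ ^ 2) * e₁₂ ^ 2
        ≈⟨ *-congʳ (trans (*-congˡ x-o₃) (sym h₋)) ⟩
      d * e₁₂ ^ 2 ∎

    x⁻¹-even-odd : e₆ ^ 2 * θ ≈ x * ((e₄ * e₄ + t) * e₁₂)
    x⁻¹-even-odd = sym (begin
      x * ((e₄ * e₄ + t) * e₁₂)             ≈⟨ *-congˡ (*-congʳ h₊) ⟩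
      x * ((o₃ * e₆) ^ 2 * g₊ * e₁₂)
        ≈⟨ solve 5 (λ x o f g e → x :* ((o :* f) :^ 2 :* g :* e) := f :^ 2 :* (g :* (x :* o :^ 2) :* e)) refl x o₃ e₆ g₊ e₁₂ ⟩
      e₆ ^ 2 * (g₊ * (x * o₃ ^ 2) * e₁₂)    ≈⟨ *-congˡ (trans (*-congʳ (*-congˡ x-o₃)) h₃) ⟩
      e₆ ^ 2 * θ                            ∎)

    squared : x⁻² * w ≈ ((e₄ * e₄ + t) * e₁₂) ^ 2
    squared = begin
      x⁻² * w                                          ≈⟨ *-congˡ (solve 2 (λ f h → f :^ 4 :* h :^ 2 := (f :^ 2 :* h) :^ 2) refl e₆ θ) ⟩
      x⁻² * (e₆ ^ 2 * θ) ^ 2                           ≈⟨ *-congˡ (^-congˡ 2 x⁻¹-even-odd) ⟩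
      x⁻² * (x * ((e₄ * e₄ + t) * e₁₂)) ^ 2
        ≈⟨ solve 3 (λ i x s → i :* (x :* s) :^ 2 := i :* x :^ 2 :* s :^ 2) refl x⁻² x ((e₄ * e₄ + t) * e₁₂) ⟩
      x⁻² * x ^ 2 * ((e₄ * e₄ + t) * e₁₂) ^ 2          ≈⟨ trans (*-congʳ hX) (*-identityˡ _) ⟩
      ((e₄ * e₄ + t) * e₁₂) ^ 2                        ∎

    first : y * w ≈ t ^ 2 * e₁₂ ^ 2
    first = begin
      y * w
        ≈⟨ *-congʳ (*-congʳ hq) ⟩
      q * q * ((e₂ ^ 2 * e₁₂ ^ 6) * r₁) * w
        ≈⟨ solve 6 (λ q e₂ e₁₂ r e₆ h → q :* q :* ((e₂ :^ 2 :* e₁₂ :^ 6) :* r) :* (e₆ :^ 4 :* h :^ 2)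
             := (q :* q :* (h :^ 2 :* e₁₂ :^ 2 :* (r :* e₆ :^ 4))) :* (e₂ :* e₁₂ :^ 2) :^ 2) refl q e₂ e₁₂ r₁ e₆ θ ⟩
      (q * q * (θ ^ 2 * e₁₂ ^ 2 * (r₁ * e₆ ^ 4))) * (e₂ * e₁₂ ^ 2) ^ 2
        ≈⟨ *-congˡ (^-congˡ 2 (sym h₄)) ⟩
      (q * q * (θ ^ 2 * e₁₂ ^ 2 * (r₁ * e₆ ^ 4))) * (θ * e₄ * e₆) ^ 2
        ≈⟨ solve 6 (λ q e₄ e₁₂ r e₆ h → (q :* q :* (h :^ 2 :* e₁₂ :^ 2 :* (r :* e₆ :^ 4))) :* (h :* e₄ :* e₆) :^ 2
             := r :* (e₄ :^ 2 :* e₆ :^ 6) :* ((q :* (h :* h)) :^ 2 :* e₁₂ :^ 2)) refl q e₄ e₁₂ r₁ e₆ θ ⟩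
      r₁ * (e₄ ^ 2 * e₆ ^ 6) * (t ^ 2 * e₁₂ ^ 2)
        ≈⟨ trans (*-congʳ hr₁) (*-identityˡ _) ⟩
      t ^ 2 * e₁₂ ^ 2 ∎

    second : z * w ≈ (e₄ * e₄) ^ 2 * e₁₂ ^ 2
    second = begin
      z * w
        ≈⟨ solve 4 (λ e₄ r e₆ h → e₄ :^ 6 :* r :* (e₆ :^ 4 :* h :^ 2) := e₄ :^ 4 :* (r :* e₆ :^ 2) :* (h :* e₄ :* e₆) :^ 2) refl e₄ r₂ e₆ θ ⟩
      e₄ ^ 4 * (r₂ * e₆ ^ 2) * (θ * e₄ * e₆) ^ 2
        ≈⟨ *-congˡ (^-congˡ 2 h₄) ⟩
      e₄ ^ 4 * (r₂ * e₆ ^ 2) * (e₂ * e₁₂ ^ 2) ^ 2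
        ≈⟨ solve 5 (λ e₄ r e₆ e₂ e₁₂ → e₄ :^ 4 :* (r :* e₆ :^ 2) :* (e₂ :* e₁₂ :^ 2) :^ 2
             := r :* (e₂ :^ 2 :* e₆ :^ 2 :* e₁₂ :^ 2) :* ((e₄ :* e₄) :^ 2 :* e₁₂ :^ 2)) refl e₄ r₂ e₆ e₂ e₁₂ ⟩
      r₂ * (e₂ ^ 2 * e₆ ^ 2 * e₁₂ ^ 2) * ((e₄ * e₄) ^ 2 * e₁₂ ^ 2)
        ≈⟨ trans (*-congʳ hr₂) (*-identityˡ _) ⟩
      (e₄ * e₄) ^ 2 * e₁₂ ^ 2 ∎

    third : q * x * w ≈ t * (d * e₁₂ ^ 2)
    third = begin
      q * x * w                        ≈⟨ solve 4 (λ q x f h → q :* x :* (f :^ 4 :* h :^ 2) := q :* (h :* h) :* (x :* f :^ 4)) refl q x e₆ θ ⟩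
      t * (x * e₆ ^ 4)                 ≈⟨ *-congˡ x-even-odd ⟩
      t * (d * e₁₂ ^ 2)                ∎

open import Defs
open import Data.Integer using (ℤ; 0ℤ; 1ℤ; -_; _+_; _*_; _-_)
import Data.Integer.Properties as ℤₚ
open import Data.Integer.Tactic.RingSolver using (solve-∀)
open import Data.List using (applyUpTo; _∷_)
open ≡ using (refl; sym; trans; cong; cong₂; module ≡-Reasoning)

-- The ring of formal power series

shift : FPS → FPS
shift f n = f (suc n)

mapL-applyUpTo-suc : ∀ (h : ℕ → ℤ) φ n →
  mapL h (applyUpTo (λ i → suc (φ i)) n) ≡ mapL (λ k → h (suc k)) (applyUpTo φ n)
mapL-applyUpTo-suc h φ zero = refl
mapL-applyUpTo-suc h φ (suc n) = cong (h (suc (φ 0)) ∷_) (mapL-applyUpTo-suc h (λ i → φ (suc i)) n)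

-- Splitting off the constant term of `f` makes convolution recursive in the degree; the ring laws
-- below are inductions along this recursion.
⊛-suc : ∀ f g n → (f ⊛ g) (suc n) ≡ f 0 * g (suc n) + (shift f ⊛ g) n
⊛-suc f g n = cong (λ l → f 0 * g (suc n) + sumℤ l) (mapL-applyUpTo-suc (λ k → f k * g (suc n ℕ.∸ k)) (λ i → i) (suc n))

⊛-zero : ∀ f g → (f ⊛ g) 0 ≡ f 0 * g 0
⊛-zero f g = ℤₚ.+-identityʳ (f 0 * g 0)

-- The bound on `t` is kept because this is also the continuity of multiplication on which the limit
-- arguments rest.
⊛-cong-upTo : ∀ {f f′ g g′} n → (∀ t → t ≤ n → f t ≡ f′ t) → (∀ t → t ≤ n → g t ≡ g′ t) →
  (f ⊛ g) n ≡ (f′ ⊛ g′) n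
⊛-cong-upTo {f} {f′} {g} {g′} zero e d = cong₂ (λ x y → x * y + 0ℤ) (e 0 z≤n) (d 0 z≤n)
⊛-cong-upTo {f} {f′} {g} {g′} (suc n) e d = begin
  (f ⊛ g) (suc n)                          ≡⟨ ⊛-suc f g n ⟩
  f 0 * g (suc n) + (shift f ⊛ g) n        ≡⟨ cong₂ _+_ (cong₂ _*_ (e 0 z≤n) (d (suc n) ℕₚ.≤-refl))
    (⊛-cong-upTo n (λ t t≤n → e (suc t) (s≤s t≤n)) (λ t t≤n → d t (ℕₚ.m≤n⇒m≤1+n t≤n))) ⟩
  f′ 0 * g′ (suc n) + (shift f′ ⊛ g′) n    ≡⟨ sym (⊛-suc f′ g′ n) ⟩
  (f′ ⊛ g′) (suc n)                        ∎
  where open ≡-Reasoning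

⊛-cong : ∀ {f f′ g g′} → f ≈ f′ → g ≈ g′ → f ⊛ g ≈ f′ ⊛ g′
⊛-cong e d n = ⊛-cong-upTo n (λ t _ → e t) (λ t _ → d t)

const-zero : ∀ n → const 0ℤ n ≡ 0ℤ
const-zero zero = refl
const-zero (suc n) = refl

shift-const : ∀ c → shift (const c) ≈ const 0ℤ
shift-const c n = sym (const-zero n)

⊛-zeroˡ : ∀ g → const 0ℤ ⊛ g ≈ const 0ℤ
⊛-zeroˡ g zero = refl
⊛-zeroˡ g (suc n) = trans (⊛-suc (const 0ℤ) g n) (trans (ℤₚ.+-identityˡ _)
  (trans (⊛-cong {g = g} {g′ = g} (shift-const 0ℤ) (λ _ → refl) n) (trans (⊛-zeroˡ g n) (const-zero n))))

⊛-constˡ : ∀ c g n → (const c ⊛ g) n ≡ c * g n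
⊛-constˡ c g zero = ⊛-zero (const c) g
⊛-constˡ c g (suc n) = trans (⊛-suc (const c) g n) (trans (cong (λ y → c * g (suc n) + y) (trans
  (⊛-cong {g = g} {g′ = g} (shift-const c) (λ _ → refl) n) (trans (⊛-zeroˡ g n) (const-zero n)))) (ℤₚ.+-identityʳ _))

⊛-distribʳ : ∀ g f h → (f ⊕ h) ⊛ g ≈ (f ⊛ g) ⊕ (h ⊛ g)
⊛-distribʳ g f h zero = trans (⊛-zero (f ⊕ h) g) (trans (ℤₚ.*-distribʳ-+ (g 0) (f 0) (h 0))
  (sym (cong₂ _+_ (⊛-zero f g) (⊛-zero h g))))
⊛-distribʳ g f h (suc n) = begin
  ((f ⊕ h) ⊛ g) (suc n)                                        ≡⟨ ⊛-suc (f ⊕ h) g n ⟩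
  (f 0 + h 0) * g (suc n) + ((shift f ⊕ shift h) ⊛ g) n
    ≡⟨ cong (((f 0 + h 0) * g (suc n)) +_) (⊛-distribʳ g (shift f) (shift h) n) ⟩
  (f 0 + h 0) * g (suc n) + ((shift f ⊛ g) n + (shift h ⊛ g) n)
    ≡⟨ rearrange (f 0) (h 0) (g (suc n)) _ _ ⟩
  (f 0 * g (suc n) + (shift f ⊛ g) n) + (h 0 * g (suc n) + (shift h ⊛ g) n)
    ≡⟨ sym (cong₂ _+_ (⊛-suc f g n) (⊛-suc h g n)) ⟩
  (f ⊛ g) (suc n) + (h ⊛ g) (suc n)                            ∎
  where
  open ≡-Reasoning
  rearrange : ∀ a b c x y → (a + b) * c + (x + y) ≡ (a * c + x) + (b * c + y)
  rearrange = solve-∀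

·-⊛ : ∀ c f g n → ((c · f) ⊛ g) n ≡ c * (f ⊛ g) n
·-⊛ c f g zero = trans (⊛-zero (c · f) g) (trans (ℤₚ.*-assoc c (f 0) (g 0)) (cong (c *_) (sym (⊛-zero f g))))
·-⊛ c f g (suc n) = trans (⊛-suc (c · f) g n) (trans (cong ((c * f 0 * g (suc n)) +_) (·-⊛ c (shift f) g n))
  (trans (rearrange c (f 0) (g (suc n)) ((shift f ⊛ g) n)) (cong (c *_) (sym (⊛-suc f g n)))))
  where
  rearrange : ∀ c a b x → c * a * b + c * x ≡ c * (a * b + x)
  rearrange = solve-∀

⊛-assoc : ∀ f g h → (f ⊛ g) ⊛ h ≈ f ⊛ (g ⊛ h)
⊛-assoc f g h zero = begin
  ((f ⊛ g) ⊛ h) 0      ≡⟨ trans (⊛-zero (f ⊛ g) h) (cong (_* h 0) (⊛-zero f g)) ⟩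
  f 0 * g 0 * h 0      ≡⟨ ℤₚ.*-assoc (f 0) (g 0) (h 0) ⟩
  f 0 * (g 0 * h 0)    ≡⟨ sym (trans (⊛-zero f (g ⊛ h)) (cong (f 0 *_) (⊛-zero g h))) ⟩
  (f ⊛ (g ⊛ h)) 0      ∎
  where open ≡-Reasoning
⊛-assoc f g h (suc n) = begin
  ((f ⊛ g) ⊛ h) (suc n)
    ≡⟨ ⊛-suc (f ⊛ g) h n ⟩
  (f ⊛ g) 0 * h (suc n) + (shift (f ⊛ g) ⊛ h) n
    ≡⟨ cong₂ (λ x y → x * h (suc n) + y) (⊛-zero f g) (⊛-cong {g = h} {g′ = h} (⊛-suc f g) (λ _ → refl) n) ⟩
  f 0 * g 0 * h (suc n) + (((f 0 · shift g) ⊕ (shift f ⊛ g)) ⊛ h) n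
    ≡⟨ cong ((f 0 * g 0 * h (suc n)) +_) (trans (⊛-distribʳ h (f 0 · shift g) (shift f ⊛ g) n)
         (cong₂ _+_ (·-⊛ (f 0) (shift g) h n) (⊛-assoc (shift f) g h n))) ⟩
  f 0 * g 0 * h (suc n) + (f 0 * (shift g ⊛ h) n + (shift f ⊛ (g ⊛ h)) n)
    ≡⟨ rearrange (f 0) (g 0) (h (suc n)) _ _ ⟩
  f 0 * (g 0 * h (suc n) + (shift g ⊛ h) n) + (shift f ⊛ (g ⊛ h)) n
    ≡⟨ cong (λ x → f 0 * x + (shift f ⊛ (g ⊛ h)) n) (sym (⊛-suc g h n)) ⟩
  f 0 * (g ⊛ h) (suc n) + (shift f ⊛ (g ⊛ h)) n
    ≡⟨ sym (⊛-suc f (g ⊛ h) n) ⟩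
  (f ⊛ (g ⊛ h)) (suc n) ∎
  where
  open ≡-Reasoning
  rearrange : ∀ a b c x y → a * b * c + (a * x + y) ≡ a * (b * c + x) + y
  rearrange = solve-∀

-- The mirror image of `⊛-suc`, needed because commutativity exchanges the two ends of the
-- convolution.
⊛-suc′ : ∀ f g n → (f ⊛ g) (suc n) ≡ (f ⊛ shift g) n + f (suc n) * g 0
⊛-suc′ f g zero = trans (⊛-suc f g 0) (cong₂ _+_ (sym (⊛-zero f (shift g))) (⊛-zero (shift f) g))
⊛-suc′ f g (suc n) = begin
  (f ⊛ g) (suc (suc n))                                                    ≡⟨ ⊛-suc f g (suc n) ⟩
  f 0 * g (suc (suc n)) + (shift f ⊛ g) (suc n)                            ≡⟨ cong (f 0 * g (suc (suc n)) +_) (⊛-suc′ (shift f) g n) ⟩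
  f 0 * g (suc (suc n)) + ((shift f ⊛ shift g) n + f (suc (suc n)) * g 0)  ≡⟨ sym (ℤₚ.+-assoc (f 0 * g (suc (suc n))) _ _) ⟩
  f 0 * g (suc (suc n)) + (shift f ⊛ shift g) n + f (suc (suc n)) * g 0    ≡⟨ cong (_+ f (suc (suc n)) * g 0) (sym (⊛-suc f (shift g) n)) ⟩
  (f ⊛ shift g) (suc n) + f (suc (suc n)) * g 0                            ∎
  where open ≡-Reasoning

⊛-comm : ∀ f g → f ⊛ g ≈ g ⊛ f
⊛-comm f g zero = trans (⊛-zero f g) (trans (ℤₚ.*-comm (f 0) (g 0)) (sym (⊛-zero g f)))
⊛-comm f g (suc n) = begin
  (f ⊛ g) (suc n)                      ≡⟨ ⊛-suc f g n ⟩
  f 0 * g (suc n) + (shift f ⊛ g) n    ≡⟨ cong₂ _+_ (ℤₚ.*-comm (f 0) (g (suc n))) (⊛-comm (shift f) g n) ⟩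
  g (suc n) * f 0 + (g ⊛ shift f) n    ≡⟨ ℤₚ.+-comm (g (suc n) * f 0) _ ⟩
  (g ⊛ shift f) n + g (suc n) * f 0    ≡⟨ sym (⊛-suc′ g f n) ⟩
  (g ⊛ f) (suc n)                      ∎
  where open ≡-Reasoning

⊛-identityˡ : ∀ f → one ⊛ f ≈ f
⊛-identityˡ f n = trans (⊛-constˡ 1ℤ f n) (ℤₚ.*-identityˡ (f n))

-- A record, with opaque operations below: otherwise every comparison of two series unfolds to coefficient sums.
infix 4 _≋_
record _≋_ (f g : FPS) : Set where
  constructor coefficientwise
  field coefficient : f ≈ g
open _≋_ public

≋-isEquivalence : IsEquivalence _≋_
≋-isEquivalence = record
  { refl = coefficientwise λ _ → refl
  ; sym = λ (coefficientwise e) → coefficientwise λ n → sym (e n)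
  ; trans = λ (coefficientwise e) (coefficientwise d) → coefficientwise λ n → trans (e n) (d n) }

infixl 6 _⊞_
infixl 7 _⊠_
infix 8 ⊟_

opaque
  _⊞_ _⊠_ : FPS → FPS → FPS
  _⊞_ = _⊕_
  _⊠_ = _⊛_

  ⊟_ : FPS → FPS
  (⊟ f) n = - f n

  ⊞-coefficient : ∀ f g n → (f ⊞ g) n ≡ f n + g n
  ⊞-coefficient f g n = refl

  ⊟-coefficient : ∀ f n → (⊟ f) n ≡ - f n
  ⊟-coefficient f n = refl

  ⊠-zero : ∀ f g → (f ⊠ g) 0 ≡ f 0 * g 0
  ⊠-zero = ⊛-zero

  ⊠-suc : ∀ f g n → (f ⊠ g) (suc n) ≡ f 0 * g (suc n) + (shift f ⊠ g) n
  ⊠-suc = ⊛-suc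

  ⊠-agree : ∀ f f′ g g′ n → (∀ t → t ≤ n → f t ≡ f′ t) → (∀ t → t ≤ n → g t ≡ g′ t) → (f ⊠ g) n ≡ (f′ ⊠ g′) n
  ⊠-agree f f′ g g′ = ⊛-cong-upTo {f} {f′} {g} {g′}

  fps-isCommutativeRing : IsCommutativeRing _≋_ _⊞_ _⊠_ ⊟_ (const 0ℤ) one
  fps-isCommutativeRing = record
    { isRing = record
      { +-isAbelianGroup = record
        { isGroup = record
          { isMonoid = record
            { isSemigroup = record
              { isMagma = record
                { isEquivalence = ≋-isEquivalence
                ; ∙-cong = λ (coefficientwise e) (coefficientwise d) → coefficientwise λ n → cong₂ _+_ (e n) (d n) }
              ; assoc = λ f g h → coefficientwise λ n → ℤₚ.+-assoc (f n) (g n) (h n) }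
            ; identity = (λ f → coefficientwise λ n → trans (cong (_+ f n) (const-zero n)) (ℤₚ.+-identityˡ (f n))) ,
                         (λ f → coefficientwise λ n → trans (cong (f n +_) (const-zero n)) (ℤₚ.+-identityʳ (f n))) }
          ; inverse = (λ f → coefficientwise λ n → trans (ℤₚ.+-inverseˡ (f n)) (sym (const-zero n))) ,
                      (λ f → coefficientwise λ n → trans (ℤₚ.+-inverseʳ (f n)) (sym (const-zero n)))
          ; ⁻¹-cong = λ (coefficientwise e) → coefficientwise λ n → cong -_ (e n) }
        ; comm = λ f g → coefficientwise λ n → ℤₚ.+-comm (f n) (g n) }
      ; *-cong = λ (coefficientwise e) (coefficientwise d) → coefficientwise (⊛-cong e d)
      ; *-assoc = λ f g h → coefficientwise (⊛-assoc f g h)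
      ; *-identity = (λ f → coefficientwise (⊛-identityˡ f)) ,
                     (λ f → coefficientwise λ n → trans (⊛-comm f one n) (⊛-identityˡ f n))
      ; distrib = (λ f g h → coefficientwise λ n → trans (⊛-comm f (g ⊕ h) n) (trans (⊛-distribʳ f g h n)
                    (cong₂ _+_ (⊛-comm g f n) (⊛-comm h f n)))) ,
                  (λ f g h → coefficientwise (⊛-distribʳ f g h)) }
    ; *-comm = λ f g → coefficientwise (⊛-comm f g) }

fpsRing : CommutativeRing 0ℓ 0ℓ
fpsRing = record { isCommutativeRing = fps-isCommutativeRing }

-- conv and revInv are private in Defs: abstracting the literal 1 in the unfolded goal lets
-- unification supply the left-hand side of inv-tail for every offset k.
mutual
  inv-tail : ∀ f k m → _ ≡ ((λ j → f (k ℕ.+ j)) ⊛ inv f) m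
  inv-tail f k zero = cong (λ i → f i * 1ℤ + 0ℤ) (sym (ℕₚ.+-identityʳ k))
  inv-tail f k (suc m) = trans
    (cong₂ _+_ (cong (λ i → f i * inv f (suc m)) (sym (ℕₚ.+-identityʳ k)))
      (trans (inv-tail f (suc k) m) (⊛-cong {g = inv f} {g′ = inv f} (λ j → cong f (sym (ℕₚ.+-suc k j))) (λ _ → refl) m)))
    (sym (⊛-suc (λ j → f (k ℕ.+ j)) (inv f) m))

  inv-suc′ : ∀ f m (c : ℕ → ℤ) → (∀ k → ((λ j → f (k ℕ.+ j)) ⊛ inv f) m ≡ c k) → inv f (suc m) ≡ - c 1
  inv-suc′ f m c e with 1
  ... | k = cong -_ (trans (inv-tail f k m) (e k))

inv-suc : ∀ f m → inv f (suc m) ≡ - (shift f ⊛ inv f) m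
inv-suc f m = inv-suc′ f m (λ k → ((λ j → f (k ℕ.+ j)) ⊛ inv f) m) (λ _ → refl)

opaque
  unfolding _⊠_

  inv-inverse : ∀ f → f 0 ≡ 1ℤ → inv f ⊠ f ≋ one
  inv-inverse f f0 = coefficientwise λ n → trans (⊛-comm (inv f) f n) (inverseʳ n)
    where
    inverseʳ : f ⊛ inv f ≈ one
    inverseʳ zero = trans (⊛-zero f (inv f)) (cong (_* 1ℤ) f0)
    inverseʳ (suc m) = trans (⊛-suc f (inv f) m) (trans
      (cong₂ (λ a b → a * b + (shift f ⊛ inv f) m) f0 (inv-suc f m)) (cancel ((shift f ⊛ inv f) m)))
      where
      cancel : ∀ y → 1ℤ * - y + y ≡ 0ℤ
      cancel = solve-∀

-- Limits and infinite products

open CommutativeRing fpsRing using (*-cong; *-congˡ; *-congʳ; +-cong; +-congˡ; +-congʳ; -‿cong; *-assoc; *-comm;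
  *-identityˡ; *-identityʳ; -‿inverseˡ; zeroʳ; distribʳ; +-assoc; +-identityʳ; ring)
  renaming (refl to ≋-refl; sym to ≋-sym; trans to ≋-trans; commutativeSemiring to fps)
open FiniteJacobi fps
open QFactorial fpsRing
open Exp fps

⊠-agreeˡ : ∀ f f′ g n → (∀ t → t ≤ n → f t ≡ f′ t) → (f ⊠ g) n ≡ (f′ ⊠ g) n
⊠-agreeˡ f f′ g n e = ⊠-agree f f′ g g n e (λ _ _ → refl)

⊠-agreeʳ : ∀ f g g′ n → (∀ t → t ≤ n → g t ≡ g′ t) → (f ⊠ g) n ≡ (f ⊠ g′) n
⊠-agreeʳ f g g′ n = ⊠-agree f f g g′ n (λ _ _ → refl)

record Order≥ (m : ℕ) (f : FPS) : Set where
  constructor order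
  field vanishes : ∀ t → t < m → f t ≡ 0ℤ
open Order≥

order-zero : ∀ {f} → Order≥ 0 f
order-zero = order λ _ ()

order-one : ∀ {f} → f 0 ≡ 0ℤ → Order≥ 1 f
order-one f0 = order λ { zero _ → f0 ; (suc _) (s≤s ()) }

order-⊠ : ∀ {m n f g} → Order≥ m f → Order≥ n g → Order≥ (m ℕ.+ n) (f ⊠ g)
order-⊠ (order ordf) (order ordg) = order (go _ _ _ ordf ordg)
  where
  go : ∀ m {n} f g → (∀ t → t < m → f t ≡ 0ℤ) → (∀ t → t < n → g t ≡ 0ℤ) → ∀ t → t < m ℕ.+ n → (f ⊠ g) t ≡ 0ℤ
  go zero f g _ ordg t t<n = begin
    (f ⊠ g) t          ≡⟨ ⊠-agreeʳ f g (const 0ℤ) t (λ s s≤t → trans (ordg s (ℕₚ.≤-<-trans s≤t t<n)) (sym (const-zero s))) ⟩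
    (f ⊠ const 0ℤ) t   ≡⟨ coefficient (zeroʳ f) t ⟩
    const 0ℤ t         ≡⟨ const-zero t ⟩
    0ℤ                 ∎
    where open ≡-Reasoning
  go (suc m) f g ordf ordg zero _ = trans (⊠-zero f g) (cong (_* g 0) (ordf 0 (s≤s z≤n)))
  go (suc m) f g ordf ordg (suc t) (s≤s t<) = trans (⊠-suc f g t)
    (cong₂ (λ c y → c * g (suc t) + y) (ordf 0 (s≤s z≤n))
      (go m (shift f) g (λ s s<m → ordf (suc s) (s≤s s<m)) ordg t t<))

order-multiple : ∀ {m f g} → Order≥ m f → Order≥ m (f ⊠ g)
order-multiple {m} ordf = order λ t t<m → vanishes (order-⊠ ordf order-zero) t (ℕₚ.≤-trans t<m (ℕₚ.m≤m+n m 0))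

order-^ : ∀ {f} → f 0 ≡ 0ℤ → ∀ n → Order≥ n (f ^ n)
order-^ f0 zero = order-zero
order-^ f0 (suc n) = order-⊠ (order-one f0) (order-^ f0 n)

-- Convergence at a fixed rate: stage `n` is already correct below degree `n`. No modulus has to be
-- carried through products, sums and reindexings.
record Lim (f : ℕ → FPS) (F : FPS) : Set where
  constructor lim
  field agrees : ∀ n t → t < n → f n t ≡ F t
open Lim

lim-unique : ∀ {f F G} → Lim f F → Lim f G → F ≋ G
lim-unique (lim limF) (lim limG) = coefficientwise λ t → trans (sym (limF (suc t) t ℕₚ.≤-refl)) (limG (suc t) t ℕₚ.≤-refl)

lim-cong : ∀ {f g F} → (∀ n → f n ≋ g n) → Lim f F → Lim g F
lim-cong e (lim limF) = lim λ n t t<n → trans (sym (coefficient (e n) t)) (limF n t t<n)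

lim-const : ∀ F → Lim (λ _ → F) F
lim-const F = lim λ n t _ → refl

lim-⊠ : ∀ {f g F G} → Lim f F → Lim g G → Lim (λ n → f n ⊠ g n) (F ⊠ G)
lim-⊠ (lim limF) (lim limG) = lim λ n t t<n → ⊠-agree _ _ _ _ t
  (λ s s≤t → limF n s (ℕₚ.≤-<-trans s≤t t<n)) (λ s s≤t → limG n s (ℕₚ.≤-<-trans s≤t t<n))

lim-⊞ : ∀ {f g F G} → Lim f F → Lim g G → Lim (λ n → f n ⊞ g n) (F ⊞ G)
lim-⊞ (lim limF) (lim limG) = lim λ n t t<n → trans (⊞-coefficient _ _ t)
  (trans (cong₂ _+_ (limF n t t<n) (limG n t t<n)) (sym (⊞-coefficient _ _ t)))

lim-reindex : ∀ {f F} (φ : ℕ → ℕ) → (∀ n → n ≤ φ n) → Lim f F → Lim (λ n → f (φ n)) F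
lim-reindex φ n≤φ (lim limF) = lim λ n t t<n → limF (φ n) t (ℕₚ.≤-trans t<n (n≤φ n))

record Unital (f : ℕ → FPS) : Set where
  constructor unital
  field trivial : ∀ j t → t ≤ j → f j t ≡ one t
open Unital

-- The cutoff after `suc t` factors is the one in `poch`, so the two agree as soon as the finite
-- products do.
infProd : (ℕ → FPS) → FPS
infProd f t = prod f (suc t) t

prod-step : ∀ {f} → Unital f → ∀ n t → t ≤ n → prod f (suc n) t ≡ prod f n t
prod-step {f} (unital u) n t t≤n = trans
  (⊠-agreeʳ (prod f n) (f n) one t (λ s s≤t → u n s (ℕₚ.≤-trans s≤t t≤n)))
  (coefficient (*-identityʳ (prod f n)) t)

prod-coefficient : ∀ {f} → Unital f → ∀ n t → t ≤ n → prod f n t ≡ infProd f t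
prod-coefficient u n t t≤n with ℕₚ.m≤n⇒m<n∨m≡n t≤n
... | inj₂ refl = sym (prod-step u n n ℕₚ.≤-refl)
prod-coefficient u (suc n) t _ | inj₁ (s≤s t≤n) = trans (prod-step u n t t≤n) (prod-coefficient u n t t≤n)

lim-prod : ∀ {f} → Unital f → Lim (prod f) (infProd f)
lim-prod u = lim λ n t t<n → prod-coefficient u n t (ℕₚ.<⇒≤ t<n)

infProd-cong : ∀ {f g} → (∀ j → f j ≋ g j) → infProd f ≋ infProd g
infProd-cong e = coefficientwise λ t → coefficient (prod-cong e (suc t)) t

unital-⊠ : ∀ {f g} → Unital f → Unital g → Unital (λ j → f j ⊠ g j)
unital-⊠ (unital u) (unital v) = unital λ j t t≤j → trans
  (⊠-agree _ _ _ _ t (λ s s≤t → u j s (ℕₚ.≤-trans s≤t t≤j)) (λ s s≤t → v j s (ℕₚ.≤-trans s≤t t≤j)))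
  (coefficient (*-identityˡ one) t)

infProd-⊠ : ∀ {f g} → Unital f → Unital g → infProd (λ j → f j ⊠ g j) ≋ infProd f ⊠ infProd g
infProd-⊠ {f} {g} u v = lim-unique
  (lim-cong (prod-* f g) (lim-prod (unital-⊠ u v))) (lim-⊠ (lim-prod u) (lim-prod v))

unital-reindex : ∀ {f} (φ : ℕ → ℕ) → (∀ n → n ≤ φ n) → Unital f → Unital (λ j → f (φ j))
unital-reindex φ n≤φ (unital u) = unital λ j t t≤j → u (φ j) t (ℕₚ.≤-trans t≤j (n≤φ j))

triple : ℕ → ℕ
triple zero = zero
triple (suc n) = suc (suc (suc (triple n)))

n≤double : ∀ n → n ≤ double n
n≤double zero = z≤n
n≤double (suc n) = s≤s (ℕₚ.m≤n⇒m≤1+n (n≤double n))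

n≤triple : ∀ n → n ≤ triple n
n≤triple zero = z≤n
n≤triple (suc n) = s≤s (ℕₚ.m≤n⇒m≤1+n (ℕₚ.m≤n⇒m≤1+n (n≤triple n)))

prod-double : ∀ f n → prod f (double n) ≋ prod (λ j → f (double j) ⊠ f (suc (double j))) n
prod-double f zero = ≋-refl
prod-double f (suc n) = ≋-trans (*-assoc _ _ _) (*-congʳ (prod-double f n))

prod-triple : ∀ f n → prod f (triple n) ≋ prod (λ j → f (triple j) ⊠ f (suc (triple j)) ⊠ f (suc (suc (triple j)))) n
prod-triple f zero = ≋-refl
prod-triple f (suc n) = ≋-trans (*-congʳ (*-assoc _ _ _)) (≋-trans (*-assoc _ _ _) (*-congʳ (prod-triple f n)))

infProd-double : ∀ {f} → Unital f → infProd f ≋ infProd (λ j → f (double j)) ⊠ infProd (λ j → f (suc (double j)))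
infProd-double {f} u = lim-unique (lim-reindex double n≤double (lim-prod u))
  (lim-cong (λ n → ≋-sym (≋-trans (prod-double f n) (prod-* _ _ n)))
    (lim-⊠ (lim-prod (unital-reindex double n≤double u))
      (lim-prod (unital-reindex (λ j → suc (double j)) (λ j → ℕₚ.m≤n⇒m≤1+n (n≤double j)) u))))

infProd-triple : ∀ {f} → Unital f → infProd f ≋
  infProd (λ j → f (triple j)) ⊠ infProd (λ j → f (suc (triple j))) ⊠ infProd (λ j → f (suc (suc (triple j))))
infProd-triple {f} u = lim-unique (lim-reindex triple n≤triple (lim-prod u))
  (lim-cong (λ n → ≋-sym (≋-trans (prod-triple f n) (≋-trans (prod-* _ _ n) (*-congʳ (prod-* _ _ n)))))
    (lim-⊠ (lim-⊠ (lim-prod (unital-reindex triple n≤triple u))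
      (lim-prod (unital-reindex (λ j → suc (triple j)) (λ j → ℕₚ.m≤n⇒m≤1+n (n≤triple j)) u)))
      (lim-prod (unital-reindex (λ j → suc (suc (triple j))) (λ j → ℕₚ.m≤n⇒m≤1+n (ℕₚ.m≤n⇒m≤1+n (n≤triple j))) u))))

-- Convergence of the finite triple product

n≤1+triangle : ∀ n → n ≤ suc (triangle n)
n≤1+triangle zero = z≤n
n≤1+triangle (suc n) = s≤s (ℕₚ.m≤m+n n (triangle n))

-- Near the edges of the sum the binomial has reached its limit only up to degree `i` or `j`, but
-- there the power of `p` is large. With `gap-right`, this says that the two effects together cover
-- every degree below `n` and `m`.
gap-left : ∀ n i → n ≤ suc i ℕ.+ gap n i
gap-left zero i = z≤n
gap-left (suc n) zero = n≤1+triangle (suc n)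
gap-left (suc n) (suc i) = s≤s (gap-left n i)

gap-right : ∀ n m i j → i ℕ.+ j ≡ n ℕ.+ m → m ≤ suc j ℕ.+ gap n i
gap-right zero m i j refl = ℕₚ.≤-trans (ℕₚ.+-monoˡ-≤ j (n≤1+triangle i)) (ℕₚ.≤-reflexive (cong suc (ℕₚ.+-comm (triangle i) j)))
gap-right (suc n) m zero j refl = ℕₚ.≤-trans (ℕₚ.m≤n+m m (suc (suc n))) (ℕₚ.m≤m+n (suc (suc n ℕ.+ m)) _)
gap-right (suc n) m (suc i) j e = gap-right n m i j (ℕₚ.suc-injective e)

⊠-near-one : ∀ {m n u f} → Order≥ m (u ⊞ ⊟ one) → Order≥ n f → ∀ t → t < m ℕ.+ n → (u ⊠ f) t ≡ f t
⊠-near-one {m} {n} {u} {f} ordu ordf t t< = begin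
  (u ⊠ f) t                                 ≡⟨ coefficient split t ⟩
  ((u ⊞ ⊟ one) ⊠ f ⊞ f) t                   ≡⟨ ⊞-coefficient _ f t ⟩
  ((u ⊞ ⊟ one) ⊠ f) t + f t                 ≡⟨ cong (_+ f t) (vanishes (order-⊠ ordu ordf) t t<) ⟩
  0ℤ + f t                                  ≡⟨ ℤₚ.+-identityˡ (f t) ⟩
  f t                                       ∎
  where
  open ≡-Reasoning
  split : u ⊠ f ≋ (u ⊞ ⊟ one) ⊠ f ⊞ f
  split = ≋-trans (*-congʳ (≋-sym (≋-trans (+-assoc u (⊟ one) one) (≋-trans (+-congˡ (-‿inverseˡ one)) (+-identityʳ u)))))
    (≋-trans (distribʳ f (u ⊞ ⊟ one) one) (+-congˡ (*-identityˡ f)))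

sum-coefficient : ∀ f g n t → (∀ i → i < n → f i t ≡ g i t) → sum f n t ≡ sum g n t
sum-coefficient f g zero t e = refl
sum-coefficient f g (suc n) t e = trans (⊞-coefficient (f 0) _ t) (trans
  (cong₂ _+_ (e 0 (s≤s z≤n)) (sum-coefficient _ _ n t (λ i i<n → e (suc i) (s≤s i<n)))) (sym (⊞-coefficient (g 0) _ t)))

order-⊟ : ∀ {m f} → Order≥ m f → Order≥ m (⊟ f)
order-⊟ {f = f} (order ordf) = order λ t t<m → trans (⊟-coefficient f t) (cong -_ (ordf t t<m))

unital-⊞ : ∀ {f : ℕ → FPS} → (∀ j → Order≥ (suc j) (f j)) → Unital (λ j → one ⊞ f j)
unital-⊞ {f} ord = unital λ j t t≤j → trans (⊞-coefficient one (f j) t)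
  (trans (cong (λ y → one t + y) (vanishes (ord j) t (s≤s t≤j))) (ℤₚ.+-identityʳ (one t)))

euler : FPS → FPS
euler p = infProd (λ j → one ⊞ ⊟ (p ^ suc j))

module _ {p : FPS} (p0 : p 0 ≡ 0ℤ) where

  euler-unital : Unital (λ j → one ⊞ ⊟ (p ^ suc j))
  euler-unital = unital-⊞ (λ j → order-⊟ (order-^ p0 (suc j)))

  euler-zero : euler p 0 ≡ 1ℤ
  euler-zero = trans (coefficient (*-identityˡ (one ⊞ ⊟ (p ^ 1))) 0) (trivial euler-unital 0 0 z≤n)

  -- Up to degree `t` all three q-factorials in `binomial-qFactorial` equal `euler p`. Hence
  -- `E * E * b` agrees with `E`, and one `E` is cancelled by its inverse.
  euler-binomial : ∀ i j t → t ≤ i → t ≤ j → (euler p ⊠ binomial p (i ℕ.+ j) i) t ≡ one t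
  euler-binomial i j t t≤i t≤j = begin
    (euler p ⊠ b) t                                ≡⟨ sym (coefficient (cancelˡ (euler p ⊠ b)) t) ⟩
    (inv (euler p) ⊠ (euler p ⊠ (euler p ⊠ b))) t  ≡⟨ ⊠-agreeʳ (inv (euler p)) (euler p ⊠ (euler p ⊠ b)) (euler p) t absorb ⟩
    (inv (euler p) ⊠ euler p) t                    ≡⟨ coefficient (inv-inverse (euler p) euler-zero) t ⟩
    one t                                          ∎
    where
    open ≡-Reasoning
    b : FPS
    b = binomial p (i ℕ.+ j) i
    cancelˡ : ∀ f → inv (euler p) ⊠ (euler p ⊠ f) ≋ f
    cancelˡ f = ≋-trans (≋-sym (*-assoc _ _ f)) (≋-trans (*-congʳ (inv-inverse (euler p) euler-zero)) (*-identityˡ f))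
    factorial : ∀ n s → s ≤ n → qFactorial p n s ≡ euler p s
    factorial = prod-coefficient euler-unital
    absorb : ∀ s → s ≤ t → (euler p ⊠ (euler p ⊠ b)) s ≡ euler p s
    absorb s s≤t = begin
      (euler p ⊠ (euler p ⊠ b)) s
        ≡⟨ coefficient (≋-trans (≋-sym (*-assoc (euler p) (euler p) b)) (*-comm (euler p ⊠ euler p) b)) s ⟩
      (b ⊠ (euler p ⊠ euler p)) s
        ≡⟨ ⊠-agreeʳ b (euler p ⊠ euler p) (qFactorial p i ⊠ qFactorial p j) s (λ r r≤s →
             ⊠-agree (euler p) (qFactorial p i) (euler p) (qFactorial p j) r
             (λ m m≤r → sym (factorial i m (ℕₚ.≤-trans m≤r (ℕₚ.≤-trans r≤s (ℕₚ.≤-trans s≤t t≤i)))))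
             (λ m m≤r → sym (factorial j m (ℕₚ.≤-trans m≤r (ℕₚ.≤-trans r≤s (ℕₚ.≤-trans s≤t t≤j)))))) ⟩
      (b ⊠ (qFactorial p i ⊠ qFactorial p j)) s  ≡⟨ coefficient (binomial-qFactorial p i j) s ⟩
      qFactorial p (i ℕ.+ j) s
        ≡⟨ factorial (i ℕ.+ j) s (ℕₚ.≤-trans (ℕₚ.≤-trans s≤t t≤i) (ℕₚ.m≤m+n i j)) ⟩
      euler p s                                  ∎

  -- The coefficients `α` are arbitrary, so the lemma covers the components of a sum over the
  -- extension as well as a triple product of power series.
  euler-sum : ∀ (α : ℕ → FPS) n m t → t < n → t < m →
    (euler p ⊠ sum (λ i → binomial p (n ℕ.+ m) i ⊠ (p ^ gap n i ⊠ α i)) (suc (n ℕ.+ m))) t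
    ≡ sum (λ i → p ^ gap n i ⊠ α i) (suc (n ℕ.+ m)) t
  euler-sum α n m t t<n t<m = trans
    (sym (coefficient (sum-*ˡ (euler p) (λ i → binomial p (n ℕ.+ m) i ⊠ (p ^ gap n i ⊠ α i)) (suc (n ℕ.+ m))) t))
    (sum-coefficient (λ i → euler p ⊠ (binomial p (n ℕ.+ m) i ⊠ (p ^ gap n i ⊠ α i))) (λ i → p ^ gap n i ⊠ α i)
      (suc (n ℕ.+ m)) t (λ { i (s≤s i≤N) → term i i≤N }))
    where
    open ≡-Reasoning
    term : ∀ i → i ≤ n ℕ.+ m →
      (euler p ⊠ (binomial p (n ℕ.+ m) i ⊠ (p ^ gap n i ⊠ α i))) t ≡ (p ^ gap n i ⊠ α i) t
    term i i≤N = begin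
      (euler p ⊠ (b ⊠ (y ⊠ α i))) t
        ≡⟨ coefficient (≋-trans (≋-sym (*-assoc (euler p) b (y ⊠ α i))) (≋-sym (*-assoc (euler p ⊠ b) y (α i)))) t ⟩
      (euler p ⊠ b ⊠ y ⊠ α i) t
        ≡⟨ ⊠-agreeˡ (euler p ⊠ b ⊠ y) y (α i) t (λ s s≤t → ⊠-near-one near (order-^ p0 (gap n i)) s
             (ℕₚ.≤-<-trans s≤t bound)) ⟩
      (y ⊠ α i) t ∎
      where
      j = n ℕ.+ m ℕ.∸ i
      i+j : i ℕ.+ j ≡ n ℕ.+ m
      i+j = ℕₚ.m+[n∸m]≡n i≤N
      b = binomial p (n ℕ.+ m) i
      y = p ^ gap n i
      subtract : ∀ s → (euler p ⊠ b) s ≡ one s → (euler p ⊠ b ⊞ ⊟ one) s ≡ 0ℤ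
      subtract s e = trans (⊞-coefficient _ (⊟ one) s) (trans (cong₂ _+_ e (⊟-coefficient one s)) (ℤₚ.+-inverseʳ (one s)))
      near : Order≥ (suc (i ⊓ j)) (euler p ⊠ b ⊞ ⊟ one)
      near = order λ { s (s≤s s≤) → subtract s (trans (cong (λ k → (euler p ⊠ binomial p k i) s) (sym i+j))
        (euler-binomial i j s (ℕₚ.≤-trans s≤ (ℕₚ.m⊓n≤m i j)) (ℕₚ.≤-trans s≤ (ℕₚ.m⊓n≤n i j)))) }
      bound : t < suc (i ⊓ j) ℕ.+ gap n i
      bound rewrite ℕₚ.+-distribʳ-⊓ (gap n i) (suc i) (suc j) =
        ℕₚ.⊓-glb (ℕₚ.≤-trans t<n (gap-left n i)) (ℕₚ.≤-trans t<m (gap-right n m i j i+j))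

-- The two sums of squares

open SignedPowers fpsRing

open RingProperties ring using (-‿distribˡ-*)

order-weaken : ∀ {m n f} → m ≤ n → Order≥ n f → Order≥ m f
order-weaken m≤n ordf = order λ t t<m → vanishes ordf t (ℕₚ.≤-trans t<m m≤n)

-- Powers of q and dissections of q-products

qpow-⊠ : ∀ m n → qpow m ⊠ qpow n ≋ qpow (m ℕ.+ n)
qpow-⊠ m n = coefficientwise (go m)
  where
  qpow-zero : ∀ t → qpow 0 t ≡ one t
  qpow-zero zero = refl
  qpow-zero (suc t) = refl
  go : ∀ m t → (qpow m ⊠ qpow n) t ≡ qpow (m ℕ.+ n) t
  go zero t = trans (⊠-agreeˡ (qpow 0) one (qpow n) t (λ s _ → qpow-zero s)) (coefficient (*-identityˡ (qpow n)) t)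
  go (suc m) zero = ⊠-zero (qpow (suc m)) (qpow n)
  go (suc m) (suc t) = trans (⊠-suc (qpow (suc m)) (qpow n) t) (trans (ℤₚ.+-identityˡ _) (go m t))

qpow-^ : ∀ s j → qpow s ^ j ≋ qpow (s ℕ.* j)
qpow-^ s zero rewrite ℕₚ.*-zeroʳ s = coefficientwise λ { zero → refl ; (suc _) → refl }
qpow-^ s (suc j) rewrite ℕₚ.*-suc s j = ≋-trans (*-congˡ (qpow-^ s j)) (qpow-⊠ s (s ℕ.* j))

qpow-order : ∀ k → Order≥ k (qpow k)
qpow-order k = order (go k)
  where
  go : ∀ k t → t < k → qpow k t ≡ 0ℤ
  go (suc k) zero _ = refl
  go (suc k) (suc t) (s≤s t<k) = go k t t<k

progression-order : ∀ r s .{{_ : NonZero r}} .{{_ : NonZero s}} j → Order≥ (suc j) (qpow (r ℕ.+ s ℕ.* j))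
progression-order r s j = order-weaken (ℕₚ.+-mono-≤ (ℕ.>-nonZero⁻¹ r) (ℕₚ.m≤n*m j s)) (qpow-order _)

minusFactor plusFactor : ℕ → ℕ → ℕ → FPS
minusFactor r s j = one ⊞ ⊟ qpow (r ℕ.+ s ℕ.* j)
plusFactor r s j = one ⊞ qpow (r ℕ.+ s ℕ.* j)

minusFactor-unital : ∀ r s .{{_ : NonZero r}} .{{_ : NonZero s}} → Unital (minusFactor r s)
minusFactor-unital r s = unital-⊞ (λ j → order-⊟ (progression-order r s j))

plusFactor-unital : ∀ r s .{{_ : NonZero r}} .{{_ : NonZero s}} → Unital (plusFactor r s)
plusFactor-unital r s = unital-⊞ (progression-order r s)

poch⁺ : ℕ → ℕ → FPS
poch⁺ r s = infProd (plusFactor r s)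

opaque
  unfolding _⊠_

  finProd≡prod : ∀ r s n → finProd r s n ≡ prod (minusFactor r s) n
  finProd≡prod r s zero = refl
  finProd≡prod r s (suc n) = cong (_⊛ (one ⊖ qpow (r ℕ.+ s ℕ.* n))) (finProd≡prod r s n)

poch-infProd : ∀ r s → poch r s ≋ infProd (minusFactor r s)
poch-infProd r s = coefficientwise λ n → cong (λ f → f n) (finProd≡prod r s (suc n))

infProd≋poch : ∀ {f} r s → (∀ j → f j ≋ minusFactor r s j) → infProd f ≋ poch r s
infProd≋poch r s e = ≋-trans (infProd-cong e) (≋-sym (poch-infProd r s))

minusFactor-reindex : ∀ {e} r s j → e ≡ r ℕ.+ s ℕ.* j → one ⊞ ⊟ qpow e ≋ minusFactor r s j
minusFactor-reindex r s j refl = ≋-refl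

poch-double : ∀ r s .{{_ : NonZero r}} .{{_ : NonZero s}} →
  poch r s ≋ poch r (2 ℕ.* s) ⊠ poch (r ℕ.+ s) (2 ℕ.* s)
poch-double r s = ≋-trans (poch-infProd r s) (≋-trans (infProd-double (minusFactor-unital r s)) (*-cong
  (infProd≋poch r (2 ℕ.* s) (λ j → minusFactor-reindex r (2 ℕ.* s) j (trans (cong (λ d → r ℕ.+ s ℕ.* d) (double≡+ j))
    (solve 3 (λ r s j → r :+ s :* (j :+ j) := r :+ (con 2 :* s) :* j) refl r s j))))
  (infProd≋poch (r ℕ.+ s) (2 ℕ.* s) (λ j → minusFactor-reindex (r ℕ.+ s) (2 ℕ.* s) j
    (trans (cong (λ d → r ℕ.+ s ℕ.* suc d) (double≡+ j))
    (solve 3 (λ r s j → r :+ s :* (con 1 :+ (j :+ j)) := (r :+ s) :+ (con 2 :* s) :* j) refl r s j))))))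
  where open +-*-Solver

triple≡* : ∀ n → triple n ≡ 3 ℕ.* n
triple≡* zero = refl
triple≡* (suc n) = trans (cong (λ d → suc (suc (suc d))) (triple≡* n)) (sym (ℕₚ.*-suc 3 n))

poch-triple : ∀ r s .{{_ : NonZero r}} .{{_ : NonZero s}} →
  poch r s ≋ poch r (3 ℕ.* s) ⊠ poch (r ℕ.+ s) (3 ℕ.* s) ⊠ poch (r ℕ.+ 2 ℕ.* s) (3 ℕ.* s)
poch-triple r s = ≋-trans (poch-infProd r s) (≋-trans (infProd-triple (minusFactor-unital r s)) (*-cong (*-cong
  (infProd≋poch r (3 ℕ.* s) (λ j → minusFactor-reindex r (3 ℕ.* s) j (trans (cong (λ d → r ℕ.+ s ℕ.* d) (triple≡* j))
    (solve 3 (λ r s j → r :+ s :* (con 3 :* j) := r :+ (con 3 :* s) :* j) refl r s j))))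
  (infProd≋poch (r ℕ.+ s) (3 ℕ.* s) (λ j → minusFactor-reindex (r ℕ.+ s) (3 ℕ.* s) j
    (trans (cong (λ d → r ℕ.+ s ℕ.* suc d) (triple≡* j))
    (solve 3 (λ r s j → r :+ s :* (con 1 :+ con 3 :* j) := (r :+ s) :+ (con 3 :* s) :* j) refl r s j)))))
  (infProd≋poch (r ℕ.+ 2 ℕ.* s) (3 ℕ.* s) (λ j → minusFactor-reindex (r ℕ.+ 2 ℕ.* s) (3 ℕ.* s) j
    (trans (cong (λ d → r ℕ.+ s ℕ.* suc (suc d)) (triple≡* j))
    (solve 3 (λ r s j → r :+ s :* (con 2 :+ con 3 :* j) := (r :+ con 2 :* s) :+ (con 3 :* s) :* j) refl r s j))))))
  where open +-*-Solver

poch-poch⁺ : ∀ r s .{{_ : NonZero r}} .{{_ : NonZero s}} → poch r s ⊠ poch⁺ r s ≋ poch (2 ℕ.* r) (2 ℕ.* s)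
poch-poch⁺ r s = ≋-trans (*-congʳ (poch-infProd r s))
  (≋-trans (≋-sym (infProd-⊠ (minusFactor-unital r s) (plusFactor-unital r s)))
    (infProd≋poch (2 ℕ.* r) (2 ℕ.* s) (λ j → ≋-trans (difference-of-squares (qpow (r ℕ.+ s ℕ.* j)))
      (≋-trans (+-congˡ (-‿cong (qpow-⊠ (r ℕ.+ s ℕ.* j) (r ℕ.+ s ℕ.* j))))
        (minusFactor-reindex (2 ℕ.* r) (2 ℕ.* s) j
          (solve 3 (λ r s j → (r :+ s :* j) :+ (r :+ s :* j) := con 2 :* r :+ (con 2 :* s) :* j) refl r s j))))))
  where open +-*-Solver


-- Theta series and their norm relation

theta : FPS → FPS → FPS → FPS
theta a b p = euler p ⊠ (infProd (λ j → one ⊞ a ⊠ p ^ j) ⊠ infProd (λ j → one ⊞ b ⊠ p ^ j))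

theta-unital : ∀ {a p} → a 0 ≡ 0ℤ → p 0 ≡ 0ℤ → Unital (λ j → one ⊞ a ⊠ p ^ j)
theta-unital a0 p0 = unital-⊞ (λ j → order-⊠ (order-one a0) (order-^ p0 j))

-- The bilateral series enters only through its symmetric partial sums, with exponents from `−n` to
-- `n`; both parity classes of the sum over the extension have this shape.
tripleProduct : ∀ a b p → a 0 ≡ 0ℤ → b 0 ≡ 0ℤ → p 0 ≡ 0ℤ → a ⊠ b ≋ p →
  Lim (λ n → sum (thetaTerm p a b n) (suc (n ℕ.+ n))) (theta a b p)
tripleProduct a b p a0 b0 p0 ab≈p = lim λ n t t<n → begin
  sum (thetaTerm p a b n) (suc (n ℕ.+ n)) t
    ≡⟨ sym (euler-sum p0 (power a b n) n n t t<n t<n) ⟩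
  (euler p ⊠ sum (λ i → binomial p (n ℕ.+ n) i ⊠ thetaTerm p a b n i) (suc (n ℕ.+ n))) t
    ≡⟨ coefficient (*-congˡ {euler p} (≋-sym (finiteTripleProduct p a b ab≈p n n))) t ⟩
  (euler p ⊠ (prod (λ j → one ⊞ a ⊠ p ^ j) n ⊠ prod (λ j → one ⊞ b ⊠ p ^ j) n)) t
    ≡⟨ agrees (lim-⊠ (lim-const (euler p)) (lim-⊠ (lim-prod (theta-unital a0 p0)) (lim-prod (theta-unital b0 p0)))) n t t<n ⟩
  theta a b p t ∎
  where open ≡-Reasoning

theta-poch : ∀ {a b p} r r′ s → a ≋ ⊟ qpow r → b ≋ ⊟ qpow r′ → p ≋ qpow s →
  theta a b p ≋ poch s s ⊠ (poch r s ⊠ poch r′ s)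
theta-poch {p = p} r r′ s a≋ b≋ p≋ = *-cong
  (infProd≋poch s s (λ j → ≋-trans (+-congˡ (-‿cong (≋-trans (^-congˡ (suc j) p≋) (qpow-^ s (suc j)))))
    (minusFactor-reindex s s j (ℕₚ.*-suc s j))))
  (*-cong (infProd≋poch r s (factor r a≋)) (infProd≋poch r′ s (factor r′ b≋)))
  where
  factor : ∀ {a} r → a ≋ ⊟ qpow r → ∀ j → one ⊞ a ⊠ p ^ j ≋ minusFactor r s j
  factor r a≋ j = +-congˡ (≋-trans (*-cong a≋ (≋-trans (^-congˡ j p≋) (qpow-^ s j)))
    (≋-trans (≋-sym (-‿distribˡ-* (qpow r) (qpow (s ℕ.* j)))) (-‿cong (qpow-⊠ r (s ℕ.* j)))))

module _ (Q : FPS) (Q0 : Q 0 ≡ 0ℤ) (Q²≈s : Q ⊠ Q ≋ qpow 2) where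

  private
    s N c p a′ b′ a″ : FPS
    s = qpow 2
    N = ⊟ Q
    c = ⊟ s
    p = N ⊠ c
    a′ = p ^ 1 ⊠ N
    b′ = p ^ 1 ⊠ (N ⊠ (c ⊠ c))
    a″ = p ^ 3 ⊠ N

    ⊠-zero-left : ∀ f g → f 0 ≡ 0ℤ → (f ⊠ g) 0 ≡ 0ℤ
    ⊠-zero-left f g f0 = trans (⊠-zero f g) (cong (_* g 0) f0)

    N0 : N 0 ≡ 0ℤ
    N0 = trans (⊟-coefficient Q 0) (cong -_ Q0)

    c0 : c 0 ≡ 0ℤ
    c0 = trans (⊟-coefficient s 0) refl

    p0 : p 0 ≡ 0ℤ
    p0 = ⊠-zero-left N c N0

    p⁴0 : (p ^ 4) 0 ≡ 0ℤ
    p⁴0 = ⊠-zero-left p (p ^ 3) p0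

    a′0 : a′ 0 ≡ 0ℤ
    a′0 = ⊠-zero-left (p ^ 1) N (⊠-zero-left p one p0)

    b′0 : b′ 0 ≡ 0ℤ
    b′0 = ⊠-zero-left (p ^ 1) (N ⊠ (c ⊠ c)) (⊠-zero-left p one p0)

    a″0 : a″ 0 ≡ 0ℤ
    a″0 = ⊠-zero-left (p ^ 3) N (⊠-zero-left p (p ^ 2) p0)

  open QuadraticExtension fps N

  private
    b : K.Carrier
    b = const 0ℤ , c

    left right : ℕ → K.Carrier
    left = KJ.prod (λ j → K.1# K.+ √N K.* ι p KE.^ j)
    right = KJ.prod (λ j → K.1# K.+ b K.* ι p KE.^ j)

    -- The centre `double n` is even, so index and exponent have the same parity. The one additional
    -- `a`-factor makes the number of terms `4n + 2`, which splits into complete even-odd pairs.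
    finite : ℕ → K.Carrier
    finite n = left (suc (double n)) K.* right (double n)

    √N-b : √N K.* b ≈ₖ ι p
    √N-b = K.trans (imaginary-* one c) (*-congˡ (*-identityˡ c) , ≋-refl)

    terms≡ : ∀ n → suc (double n ℕ.+ suc (double n)) ≡ double (suc (n ℕ.+ n))
    terms≡ n = trans (cong₂ (λ d e → suc (d ℕ.+ suc e)) (double≡+ n) (double≡+ n))
      (trans (solve 1 (λ n → con 1 :+ ((n :+ n) :+ (con 1 :+ (n :+ n))) := con 2 :+ ((n :+ n) :+ (n :+ n))) refl n)
        (cong (λ d → suc (suc d)) (sym (double≡+ (n ℕ.+ n)))))
      where open +-*-Solver

    lim-even : Lim (λ n → euler p ⊠ proj₁ (finite n)) (theta a′ b′ (p ^ 4))
    lim-even = lim λ n t t<n → begin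
      (euler p ⊠ proj₁ (finite n)) t
        ≡⟨ coefficient (*-congˡ {euler p} (proj₁ (finiteTripleProduct-components p √N b √N-b (suc (double n)) (double n)))) t ⟩
      (euler p ⊠ sum (λ i → binomial p (double n ℕ.+ suc (double n)) i
        ⊠ (p ^ gap (double n) i ⊠ proj₁ (KJ.power √N b (double n) i))) (suc (double n ℕ.+ suc (double n)))) t
        ≡⟨ euler-sum p0 (λ i → proj₁ (KJ.power √N b (double n) i)) (double n) (suc (double n)) t
             (ℕₚ.≤-trans t<n (n≤double n)) (ℕₚ.m≤n⇒m≤1+n (ℕₚ.≤-trans t<n (n≤double n))) ⟩
      sum (λ i → proj₁ (component c p ≋-refl (double n) i)) (suc (double n ℕ.+ suc (double n))) t
        ≡⟨ cong (λ m → sum (λ i → proj₁ (component c p ≋-refl (double n) i)) m t) (terms≡ n) ⟩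
      sum (λ i → proj₁ (component c p ≋-refl (double n) i)) (double (suc (n ℕ.+ n))) t
        ≡⟨ coefficient (proj₁ (sum-component c p ≋-refl n (suc (n ℕ.+ n)))) t ⟩
      sum (thetaTerm (p ^ 4) a′ b′ n) (suc (n ℕ.+ n)) t
        ≡⟨ agrees (tripleProduct a′ b′ (p ^ 4) a′0 b′0 p⁴0 (even-product Q s Q²≈s)) n t t<n ⟩
      theta a′ b′ (p ^ 4) t ∎
      where open ≡-Reasoning

    lim-odd : Lim (λ n → euler p ⊠ proj₂ (finite n)) (theta a″ c (p ^ 4))
    lim-odd = lim λ n t t<n → begin
      (euler p ⊠ proj₂ (finite n)) t
        ≡⟨ coefficient (*-congˡ {euler p} (proj₂ (finiteTripleProduct-components p √N b √N-b (suc (double n)) (double n)))) t ⟩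
      (euler p ⊠ sum (λ i → binomial p (double n ℕ.+ suc (double n)) i
        ⊠ (p ^ gap (double n) i ⊠ proj₂ (KJ.power √N b (double n) i))) (suc (double n ℕ.+ suc (double n)))) t
        ≡⟨ euler-sum p0 (λ i → proj₂ (KJ.power √N b (double n) i)) (double n) (suc (double n)) t
             (ℕₚ.≤-trans t<n (n≤double n)) (ℕₚ.m≤n⇒m≤1+n (ℕₚ.≤-trans t<n (n≤double n))) ⟩
      sum (λ i → proj₂ (component c p ≋-refl (double n) i)) (suc (double n ℕ.+ suc (double n))) t
        ≡⟨ cong (λ m → sum (λ i → proj₂ (component c p ≋-refl (double n) i)) m t) (terms≡ n) ⟩
      sum (λ i → proj₂ (component c p ≋-refl (double n) i)) (double (suc (n ℕ.+ n))) t
        ≡⟨ coefficient (proj₂ (sum-component c p ≋-refl n (suc (n ℕ.+ n)))) t ⟩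
      sum (thetaTerm (p ^ 4) a″ c n) (suc (n ℕ.+ n)) t
        ≡⟨ agrees (tripleProduct a″ c (p ^ 4) a″0 c0 p⁴0 (odd-product Q s Q²≈s)) n t t<n ⟩
      theta a″ c (p ^ 4) t ∎
      where open ≡-Reasoning

    normFactor : FPS → ℕ → FPS
    normFactor d j = one ⊞ Q ⊠ (d ⊠ p ^ j ⊠ (d ⊠ p ^ j))

    normFactor-unital : ∀ d → Unital (normFactor d)
    normFactor-unital d = unital-⊞ (λ j → order-⊠ (order-one Q0) (order-multiple (order-⊠ order-zero (order-^ p0 j))))

    norm-finite : ∀ n → norm Q (finite n) ≋ prod (normFactor one) (suc (double n)) ⊠ prod (normFactor c) (double n)
    norm-finite n = ≋-trans (norm-* Q (-‿inverseˡ Q) (left (suc (double n))) (right (double n)))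
      (*-cong (norm-prod Q (-‿inverseˡ Q) one p (suc (double n))) (norm-prod Q (-‿inverseˡ Q) c p (double n)))

  -- Both sides are limits of the norm of `euler p` times `finite n`: computed from the components
  -- on the left, and factor by factor on the right.
  theta-norm : theta a′ b′ (p ^ 4) ⊠ theta a′ b′ (p ^ 4) ⊞ Q ⊠ (theta a″ c (p ^ 4) ⊠ theta a″ c (p ^ 4))
    ≋ (euler p ⊠ euler p) ⊠ (infProd (normFactor one) ⊠ infProd (normFactor c))
  theta-norm = lim-unique
    (lim-⊞ (lim-⊠ lim-even lim-even) (lim-⊠ (lim-const Q) (lim-⊠ lim-odd lim-odd)))
    (lim-cong (λ n → ≋-trans (*-congˡ (≋-sym (norm-finite n))) (≋-sym (norm-scale Q (euler p) (finite n))))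
      (lim-⊠ (lim-const (euler p ⊠ euler p)) (lim-⊠
        (lim-reindex (λ n → suc (double n)) (λ n → ℕₚ.m≤n⇒m≤1+n (n≤double n)) (lim-prod (normFactor-unital one)))
        (lim-reindex double n≤double (lim-prod (normFactor-unital c))))))

  private
    p²≋q⁶ : p ⊠ p ≋ qpow 6
    p²≋q⁶ = ≋-trans (p² Q s Q²≈s) (qpow-^ 2 3)

    p⁴≋q¹² : p ^ 4 ≋ qpow 12
    p⁴≋q¹² = ≋-trans (p⁴ Q s Q²≈s) (qpow-^ 2 6)

    even-theta : theta a′ b′ (p ^ 4) ≋ poch 12 12 ⊠ (poch 4 12 ⊠ poch 8 12)
    even-theta = theta-poch 4 8 12 (≋-trans (pN Q s Q²≈s) (-‿cong (qpow-⊠ 2 2)))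
      (≋-trans (pNc² Q s Q²≈s) (-‿cong (≋-trans (*-congʳ (qpow-^ 2 3)) (qpow-⊠ 6 2)))) p⁴≋q¹²

    odd-theta : theta a″ c (p ^ 4) ≋ poch 12 12 ⊠ (poch 10 12 ⊠ poch 2 12)
    odd-theta = theta-poch 10 2 12 (≋-trans (p³N Q s Q²≈s) (-‿cong (≋-trans (*-congʳ (qpow-^ 2 4)) (qpow-⊠ 8 2)))) ≋-refl p⁴≋q¹²

    even-power : ∀ j → p ^ double j ≋ qpow (6 ℕ.* j)
    even-power j = ≋-trans (^-double p j) (≋-trans (^-congˡ j p²≋q⁶) (qpow-^ 6 j))

    -- Because `p ⊠ p` is `q^6` for either sign, only the factors with odd powers of `p` still
    -- involve `Q`.
    euler-split : euler p ≋ infProd (λ j → one ⊞ ⊟ (Q ⊠ qpow (2 ℕ.+ 6 ℕ.* j))) ⊠ poch 6 6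
    euler-split = ≋-trans (infProd-double (euler-unital p0)) (*-cong
      (infProd-cong (λ j → +-congˡ (-‿cong (≋-trans (*-cong (p≈Qs Q s Q²≈s) (even-power j))
        (≋-trans (*-assoc Q (qpow 2) (qpow (6 ℕ.* j))) (*-congˡ (qpow-⊠ 2 (6 ℕ.* j))))))))
      (infProd≋poch 6 6 (λ j → +-congˡ (-‿cong (≋-trans (≋-sym (*-assoc p p (p ^ double j)))
        (≋-trans (*-cong p²≋q⁶ (even-power j)) (qpow-⊠ 6 (6 ℕ.* j))))))))

    normFactor-qpow : ∀ {d} r → d ⊠ d ≋ qpow r → ∀ j → normFactor d j ≋ one ⊞ Q ⊠ qpow (r ℕ.+ 6 ℕ.* j)
    normFactor-qpow {d} r d² j = +-congˡ (*-congˡ (≋-trans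
      (solve 2 (λ d y → (d :* y) :* (d :* y) := (d :* d) :* (y :* y)) ≋-refl d (p ^ j))
      (≋-trans (*-cong d² (≋-trans (≋-sym (^-distrib-* p p j)) (≋-trans (^-congˡ j p²≋q⁶) (qpow-^ 6 j))))
        (qpow-⊠ r (6 ℕ.* j)))))
      where open NatSolver fps using (solve; _:=_; _:*_)

  theta-identity :
    (poch 12 12 ⊠ (poch 4 12 ⊠ poch 8 12)) ⊠ (poch 12 12 ⊠ (poch 4 12 ⊠ poch 8 12))
      ⊞ Q ⊠ ((poch 12 12 ⊠ (poch 10 12 ⊠ poch 2 12)) ⊠ (poch 12 12 ⊠ (poch 10 12 ⊠ poch 2 12)))
    ≋ (infProd (λ j → one ⊞ ⊟ (Q ⊠ qpow (2 ℕ.+ 6 ℕ.* j))) ⊠ poch 6 6) ^ 2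
      ⊠ (infProd (λ j → one ⊞ Q ⊠ qpow (0 ℕ.+ 6 ℕ.* j)) ⊠ infProd (λ j → one ⊞ Q ⊠ qpow (4 ℕ.+ 6 ℕ.* j)))
  theta-identity = ≋-trans (≋-sym (+-cong (*-cong even-theta even-theta) (*-congˡ (*-cong odd-theta odd-theta))))
    (≋-trans theta-norm (*-cong
      (≋-trans (*-cong euler-split euler-split) (*-congˡ (≋-sym (*-identityʳ _))))
      (*-cong (infProd-cong (normFactor-qpow 0 (≋-trans (*-identityˡ one) (qpow-^ 2 0))))
        (infProd-cong (normFactor-qpow 4 (≋-trans (neg-*-neg s s) (qpow-⊠ 2 2)))))))

-- Specialization to both signs and assembly

open import Data.Integer using (+_)

open Elimination fps using (eliminate)
open NatSolver fps using (solve; _:=_; _:*_; _:^_)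

private
  q θ : FPS
  q = qpow 1
  θ = poch 12 12 ⊠ (poch 10 12 ⊠ poch 2 12)

poch-4-4 : poch 4 4 ≋ poch 12 12 ⊠ (poch 4 12 ⊠ poch 8 12)
poch-4-4 = ≋-trans (poch-triple 4 4) (*-comm (poch 4 12 ⊠ poch 8 12) (poch 12 12))

sum-of-squares : poch 4 4 ⊠ poch 4 4 ⊞ q ⊠ (θ ⊠ θ) ≋ (poch 3 6 ⊠ poch 6 6) ^ 2 ⊠ (poch⁺ 1 6 ⊠ poch⁺ 5 6)
sum-of-squares = ≋-trans (+-congʳ (*-cong poch-4-4 poch-4-4)) (≋-trans (theta-identity q refl (qpow-⊠ 1 1))
  (*-cong (^-congˡ 2 (*-congʳ (infProd≋poch 3 6 (λ j → +-congˡ (-‿cong (qpow-⊠ 1 (2 ℕ.+ 6 ℕ.* j)))))))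
    (*-cong (infProd-cong (λ j → +-congˡ (qpow-⊠ 1 (6 ℕ.* j)))) (infProd-cong (λ j → +-congˡ (qpow-⊠ 1 (4 ℕ.+ 6 ℕ.* j)))))))

difference-of-squares-theta : poch 4 4 ⊠ poch 4 4 ⊞ ⊟ q ⊠ (θ ⊠ θ) ≋ (poch⁺ 3 6 ⊠ poch 6 6) ^ 2 ⊠ (poch 1 6 ⊠ poch 5 6)
difference-of-squares-theta = ≋-trans (+-congʳ (*-cong poch-4-4 poch-4-4))
  (≋-trans (theta-identity (⊟ q) (⊟-coefficient q 0) (≋-trans (neg-*-neg q q) (qpow-⊠ 1 1)))
    (*-cong (^-congˡ 2 (*-congʳ (infProd-cong (λ j → +-congˡ (≋-trans (-‿cong (negated (2 ℕ.+ 6 ℕ.* j)))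
        (GroupProperties.⁻¹-involutive (CommutativeRing.+-group fpsRing) (qpow (3 ℕ.+ 6 ℕ.* j))))))))
      (*-cong (infProd≋poch 1 6 (λ j → +-congˡ (negated (6 ℕ.* j)))) (infProd≋poch 5 6 (λ j → +-congˡ (negated (4 ℕ.+ 6 ℕ.* j)))))))
  where
  negated : ∀ k → ⊟ q ⊠ qpow k ≋ ⊟ qpow (suc k)
  negated k = ≋-trans (≋-sym (-‿distribˡ-* q (qpow k))) (-‿cong (qpow-⊠ 1 k))

⊠-monic : ∀ f g → f 0 ≡ 1ℤ → g 0 ≡ 1ℤ → (f ⊠ g) 0 ≡ 1ℤ
⊠-monic f g f0 g0 = trans (⊠-zero f g) (cong₂ _*_ f0 g0)

^-monic : ∀ f n → f 0 ≡ 1ℤ → (f ^ n) 0 ≡ 1ℤ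
^-monic f zero f0 = refl
^-monic f (suc n) f0 = ⊠-monic f (f ^ n) f0 (^-monic f n f0)

private
  o₁ o₃ u₃ g₊ g₋ e₂ e₄ e₆ e₁₂ ξ : FPS
  o₁ = poch 1 2
  o₃ = poch 3 6
  u₃ = poch⁺ 3 6
  g₊ = poch⁺ 1 6 ⊠ poch⁺ 5 6
  g₋ = poch 1 6 ⊠ poch 5 6
  e₂ = poch 2 2
  e₄ = poch 4 4
  e₆ = poch 6 6
  e₁₂ = poch 12 12
  ξ = o₁ ⊠ inv (o₃ ^ 3)

  o₁-factor : o₁ ≋ g₋ ⊠ o₃
  o₁-factor = ≋-trans (poch-triple 1 2) (solve 3 (λ a b c → a :* b :* c := a :* c :* b) ≋-refl (poch 1 6) (poch 3 6) (poch 5 6))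

  e₆-factor : o₃ ⊠ u₃ ⊠ e₁₂ ≋ e₆
  e₆-factor = ≋-trans (*-congʳ (poch-poch⁺ 3 6)) (≋-sym (poch-double 6 6))

  θ-factor : g₊ ⊠ g₋ ⊠ e₁₂ ≋ θ
  θ-factor = ≋-trans
    (solve 5 (λ a b c d e → a :* b :* (c :* d) :* e := e :* ((d :* b) :* (c :* a))) ≋-refl (poch⁺ 1 6) (poch⁺ 5 6) (poch 1 6) (poch 5 6) e₁₂)
    (*-congˡ (*-cong (poch-poch⁺ 5 6) (poch-poch⁺ 1 6)))

  -- Modulo 12, `E_2 / E_6` consists of the residues 2, 4, 8, 10. The series `θ` supplies 2 and 10,
  -- and `E_4` supplies 4 and 8, each with one factor `E_12`.
  e₂-factor : θ ⊠ e₄ ⊠ e₆ ≋ e₂ ⊠ e₁₂ ^ 2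
  e₂-factor = ≋-trans (*-congʳ (*-congˡ poch-4-4)) (≋-trans
    (solve 6 (λ a b c d e f → e :* (c :* a) :* (e :* (b :* d)) :* f := (a :* d) :* (b :* c) :* f :* e :^ 2)
      ≋-refl (poch 2 12) (poch 4 12) (poch 10 12) (poch 8 12) e₁₂ e₆)
    (*-congʳ (≋-sym (≋-trans (poch-triple 2 2) (*-congʳ (*-cong (poch-double 2 6) (poch-double 4 6)))))))

  square-split : (e₄ ⊠ e₄ ⊞ ⊟ q ⊠ (θ ⊠ θ)) ⊞ q ⊠ (θ ⊠ θ) ≋ e₄ ⊠ e₄
  square-split = ≋-trans (+-assoc (e₄ ⊠ e₄) (⊟ q ⊠ (θ ⊠ θ)) (q ⊠ (θ ⊠ θ)))
    (≋-trans (+-congˡ (≋-trans (+-congʳ (≋-sym (-‿distribˡ-* q (θ ⊠ θ)))) (-‿inverseˡ (q ⊠ (θ ⊠ θ))))) (+-identityʳ (e₄ ⊠ e₄)))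

  θ-monic : θ 0 ≡ 1ℤ
  θ-monic = ⊠-monic e₁₂ _ refl (⊠-monic (poch 10 12) (poch 2 12) refl refl)

  e₄e₆ e₂e₆e₁₂ : FPS
  e₄e₆ = e₄ ^ 2 ⊠ e₆ ^ 6
  e₂e₆e₁₂ = e₂ ^ 2 ⊠ e₆ ^ 2 ⊠ e₁₂ ^ 2

  tripled : FPS
  tripled = qpow 2 ⊠ ((e₂ ^ 2 ⊠ e₁₂ ^ 6) ⊠ inv e₄e₆)

  eliminated : inv (ξ ^ 2) ≋ (tripled ⊞ tripled ⊞ tripled ⊞ e₄ ^ 6 ⊠ inv e₂e₆e₁₂) ⊞ (q ⊠ ξ ⊞ q ⊠ ξ)
  eliminated = eliminate {w⁻¹ = inv (e₆ ^ 4 ⊠ θ ^ 2)} (≋-sym (qpow-⊠ 1 1))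
    (≋-trans (*-assoc o₁ (inv (o₃ ^ 3)) (o₃ ^ 3)) (≋-trans (*-congˡ (inv-inverse (o₃ ^ 3) (^-monic o₃ 3 refl))) (*-identityʳ o₁)))
    (inv-inverse o₃ refl) o₁-factor sum-of-squares difference-of-squares-theta square-split e₆-factor θ-factor e₂-factor
    (inv-inverse (ξ ^ 2) (^-monic ξ 2 (⊠-monic o₁ (inv (o₃ ^ 3)) refl refl)))
    (inv-inverse (e₆ ^ 4 ⊠ θ ^ 2) (⊠-monic (e₆ ^ 4) (θ ^ 2) (^-monic e₆ 4 refl) (^-monic θ 2 θ-monic)))
    (inv-inverse e₄e₆ (⊠-monic (e₄ ^ 2) (e₆ ^ 6) (^-monic e₄ 2 refl) (^-monic e₆ 6 refl)))
    (inv-inverse e₂e₆e₁₂ (⊠-monic (e₂ ^ 2 ⊠ e₆ ^ 2) (e₁₂ ^ 2)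
      (⊠-monic (e₂ ^ 2) (e₆ ^ 2) (^-monic e₂ 2 refl) (^-monic e₆ 2 refl)) (^-monic e₁₂ 2 refl)))

rearrange : ∀ f y z w → f ≋ (y ⊞ y ⊞ y ⊞ z) ⊞ (w ⊞ w) → f ⊖ (+ 2) · w ≈ (+ 3) · y ⊕ z
rearrange f y z w (coefficientwise e) n = trans (cong (_- (+ 2) * w n) (trans (e n) expand)) (collect (y n) (z n) (w n))
  where
  expand : ((y ⊞ y ⊞ y ⊞ z) ⊞ (w ⊞ w)) n ≡ (y n + y n + y n + z n) + (w n + w n)
  expand = trans (⊞-coefficient _ _ n) (cong₂ _+_ (trans (⊞-coefficient _ _ n) (cong (_+ z n)
    (trans (⊞-coefficient _ _ n) (cong (_+ y n) (⊞-coefficient y y n))))) (⊞-coefficient w w n))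
  collect : ∀ a b c → (a + a + a + b) + (c + c) - (+ 2) * c ≡ (+ 3) * a + b
  collect = solve-∀

opaque
  unfolding _⊠_

  cubicContinuedFractionIdentity : inv (x ^ₛ 2) ⊖ (+ 2) · (qpow 1 ⊛ x)
    ≈ (+ 3) · (qpow 2 ⊛ ((poch 2 2 ^ₛ 2 ⊛ poch 12 12 ^ₛ 6)
    ⊛ inv (poch 4 4 ^ₛ 2 ⊛ poch 6 6 ^ₛ 6)))
    ⊕ (poch 4 4 ^ₛ 6
    ⊛ inv (poch 2 2 ^ₛ 2 ⊛ poch 6 6 ^ₛ 2 ⊛ poch 12 12 ^ₛ 2))
  -- With the opaque product unfolded, `ξ` is `x` and ring powers are `_^ₛ_` by computation, so only
  -- the sums and scalar multiples need rewriting.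
  cubicContinuedFractionIdentity = rearrange (inv (ξ ^ 2)) tripled (e₄ ^ 6 ⊠ inv e₂e₆e₁₂) (q ⊠ ξ) eliminated

theorem2p2 : inv (x ^ₛ 2) ⊖ (+ 2) · (qpow 1 ⊛ x)
    ≈ (+ 3) · (qpow 2 ⊛ ((poch 2 2 ^ₛ 2 ⊛ poch 12 12 ^ₛ 6)
    ⊛ inv (poch 4 4 ^ₛ 2 ⊛ poch 6 6 ^ₛ 6)))
    ⊕ (poch 4 4 ^ₛ 6
    ⊛ inv (poch 2 2 ^ₛ 2 ⊛ poch 6 6 ^ₛ 2 ⊛ poch 12 12 ^ₛ 2))
theorem2p2 = cubicContinuedFractionIdentity
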